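{- Let $m\ge3$ and let $d$ be a positive integer with $d^2\equiv1\pmod{2^m-1}$ whose binary Hamming weight satisfies $wt(d)>1$. Let $\alpha_1,\alpha_2,\alpha_3\in\mathbb{F}_{2^m}^*$ be pairwise distinct with $\alpha_i^{d+1}=1$, let $\alpha_4=\alpha_1+\alpha_2+\alpha_3$ satisfy $\alpha_4^{d+1}=1$, and let $\pi_i(y)=\alpha_iy^d$ ($i=1,2,3,4$); assume moreover that $\pi_1,\dots,\pi_4$ have the property $(P_1)$. Let $\sigma$ be a permutation of $\{\alpha_1,\alpha_2,\alpha_3,\alpha_4\}$, $k$ a positive integer, $\beta_1=\sigma(\alpha_2)/\alpha_1^k$, $\beta_2=\sigma(\alpha_3)/\alpha_2^k$, $\beta_3=\sigma(\alpha_4)/\alpha_3^k$, $\beta_4=\sigma(\alpha_1)/\alpha_4^k$, $h_i(y)=Tr(\beta_iy^k)$ for $i=1,2,3$, $h_4(y)=Tr(\beta_4y^k)+1$, and $f_i(x,y)=Tr(x\pi_i(y))+h_i(y)$ for $x,y\in\mathbb{F}_{2^m}$. Then $f=f_1\|f_2\|f_3\|f_4$ is a bent function in $2m+2$ variables and $f\notin\mathcal{M}^\#$.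
   Context: $Tr$ is the absolute trace of $\mathbb{F}_{2^m}$; functions on $\mathbb{F}_{2^m}\times\mathbb{F}_{2^m}$ are identified with functions on $\mathbb{F}_2^{2m}$ via a basis. A mapping $\pi\colon\mathbb{F}_2^m\to\mathbb{F}_2^m$ has property $(P_1)$ if for all linearly independent $v,w$ and all $y$, $\pi(y)+\pi(y+v)+\pi(y+w)+\pi(y+v+w)\ne0$. A Boolean function $g$ on $\mathbb{F}_2^N$ ($N$ even) is bent if $\sum_z(-1)^{g(z)+a\cdot z}=\pm2^{N/2}$ for all $a$. The Maiorana–McFarland class $\mathcal{M}$ on $\mathbb{F}_2^{2k}$ consists of $(x,y)\mapsto x\cdot\pi(y)+h(y)$ with $\pi$ a permutation of $\mathbb{F}_2^k$ and $h$ arbitrary; $\mathcal{M}^\#$ is its closure under extended-affine equivalence ($g'=g\circ A+l$, $A$ affine permutation, $l$ affine). For $g_1,\dots,g_4$ on $\mathbb{F}_2^n$, $g_1\|g_2\|g_3\|g_4$ is the function $(z,z_{n+1},z_{n+2})\mapsto g_1(z)+z_{n+1}(g_1+g_3)(z)+z_{n+2}(g_1+g_2)(z)+z_{n+1}z_{n+2}(g_1+g_2+g_3+g_4)(z)$ on $\mathbb{F}_2^{n+2}$. -}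

module Defs where

open import Data.Bool using (Bool; true; false; _xor_; _∧_; not; if_then_else_)
open import Data.Nat as N using (ℕ; zero; suc; _^_)
open import Data.Nat.DivMod using (_/_; _%_)
open import Data.Integer as ℤ using (ℤ)
open import Data.Fin as Fin using (Fin)
open import Data.Vec using (Vec; []; _∷_; _++_; take; drop; map; foldr; zipWith; replicate)
open import Data.List as List using (List)
open import Data.Product using (Σ; _×_; _,_; ∃)
open import Data.Sum using (_⊎_)
open import Relation.Nullary using (¬_; does)
open import Relation.Binary.PropositionalEquality using (_≡_; subst; sym)
open import Relation.Binary.Definitions using (DecidableEquality)
open import Algebra.Structures using (IsCommutativeRing)
open import Function.Definitions using (Bijective)

BV : ℕ → Set
BV n = Vec Bool n

infixl 6 _⊕_
_⊕_ : ∀ {n} → BV n → BV n → BV n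
_⊕_ = zipWith _xor_

zeroV : ∀ {n} → BV n
zeroV = replicate _ false

_·ᵥ_ : ∀ {n} → Bool → BV n → BV n
b ·ᵥ v = map (b ∧_) v

dot : ∀ {n} → BV n → BV n → Bool
dot u v = foldr _ _xor_ false (zipWith _∧_ u v)

allVec : (n : ℕ) → List (BV n)
allVec zero    = [] List.∷ List.[]
allVec (suc n) = List.map (false ∷_) (allVec n) List.++ List.map (true ∷_) (allVec n)

sign : Bool → ℤ
sign false = ℤ.+ 1
sign true  = ℤ.- (ℤ.+ 1)

walsh : ∀ {N} → (BV N → Bool) → BV N → ℤ
walsh {N} g a = List.foldr ℤ._+_ (ℤ.+ 0) (List.map (λ z → sign (g z xor dot a z)) (allVec N))

-- bent (N is even in all uses)
IsBent : (N : ℕ) → (BV N → Bool) → Set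
IsBent N g = ∀ a → walsh g a ≡ ℤ.+ (2 ^ (N / 2)) ⊎ walsh g a ≡ ℤ.- (ℤ.+ (2 ^ (N / 2)))

MMfun : (k : ℕ) → (BV k → BV k) → (BV k → Bool) → BV (k N.+ k) → Bool
MMfun k π h z = dot (take k z) (π (drop k z)) xor h (drop k z)

InM : (k : ℕ) → (BV (k N.+ k) → Bool) → Set
InM k g = Σ (BV k → BV k) λ π → Σ (BV k → Bool) λ h →
  Bijective _≡_ _≡_ π × (∀ z → g z ≡ MMfun k π h z)

Mat : ℕ → Set
Mat N = Vec (BV N) N

matApply : ∀ {N} → Mat N → BV N → BV N
matApply M z = map (λ row → dot row z) M

IsAffinePerm : ∀ {N} → (BV N → BV N) → Set
IsAffinePerm {N} A = Σ (Mat N) λ M → Σ (BV N) λ c →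
  (∀ z → A z ≡ matApply M z ⊕ c) × Bijective _≡_ _≡_ A

IsAffineFun : ∀ {N} → (BV N → Bool) → Set
IsAffineFun {N} l = Σ (BV N) λ a → Σ Bool λ c → ∀ z → l z ≡ (dot a z xor c)

InM# : (N : ℕ) → (BV N → Bool) → Set
InM# N g = Σ ℕ λ k → Σ (k N.+ k ≡ N) λ e →
  Σ (BV (k N.+ k) → Bool) λ g' → Σ (BV N → BV N) λ A → Σ (BV N → Bool) λ l →
  InM k g' × IsAffinePerm A × IsAffineFun l ×
  (∀ z → g z ≡ (g' (subst BV (sym e) (A z)) xor l z))

concat4 : ∀ {n} → (g₁ g₂ g₃ g₄ : BV n → Bool) → BV (n N.+ 2) → Bool
concat4 {n} g₁ g₂ g₃ g₄ w with take n w | drop n w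
... | z | (z₁ ∷ z₂ ∷ []) =
  g₁ z xor (z₁ ∧ (g₁ z xor g₃ z)) xor (z₂ ∧ (g₁ z xor g₂ z))
       xor (z₁ ∧ z₂ ∧ (g₁ z xor g₂ z xor g₃ z xor g₄ z))

wtAux : ℕ → ℕ → ℕ
wtAux zero    n = 0
wtAux (suc f) n = n % 2 N.+ wtAux f (n / 2)

wt : ℕ → ℕ
wt n = wtAux n n   -- n bits of fuel are always enough

-- A model of F_{2^m}: a field together with a coordinate map to F_2^m
-- w.r.t. some F_2-basis (an additive bijection).

record GF2^ (m : ℕ) : Set₁ where
  infixl 6 _+_
  infixl 7 _*_
  field
    Carrier  : Set
    _+_ _*_  : Carrier → Carrier → Carrier
    -_       : Carrier → Carrier
    0# 1#    : Carrier
    isCommutativeRing : IsCommutativeRing _≡_ _+_ _*_ -_ 0# 1#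
    inv      : Carrier → Carrier
    inv-r    : ∀ x → ¬ x ≡ 0# → x * inv x ≡ 1#
    1≢0      : ¬ 1# ≡ 0#
    _≟_      : DecidableEquality Carrier
    coord    : Carrier → BV m
    uncoord  : BV m → Carrier
    coord-uncoord : ∀ v → coord (uncoord v) ≡ v
    uncoord-coord : ∀ x → uncoord (coord x) ≡ x
    coord-+  : ∀ x y → coord (x + y) ≡ coord x ⊕ coord y

  _^ᶠ_ : Carrier → ℕ → Carrier
  x ^ᶠ zero  = 1#
  x ^ᶠ suc n = x * (x ^ᶠ n)

  Tr : Carrier → Carrier
  Tr x = go m
    where
    go : ℕ → Carrier
    go zero    = 0#
    go (suc i) = (x ^ᶠ (2 ^ i)) + go i

  -- the trace as an element of F_2 = Bool (Tr x ∈ {0,1})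
  tr : Carrier → Bool
  tr x = not (does (Tr x ≟ 0#))

  toBool2 : (Carrier → Carrier → Bool) → BV (m N.+ m) → Bool
  toBool2 g z = g (uncoord (take m z)) (uncoord (drop m z))

  toVecMap : (Carrier → Carrier) → BV m → BV m
  toVecMap π v = coord (π (uncoord v))

LinIndep : ∀ {n} → BV n → BV n → Set
LinIndep v w = ∀ a b → (a ·ᵥ v) ⊕ (b ·ᵥ w) ≡ zeroV → a ≡ false × b ≡ false

P1 : ∀ {n} → (BV n → BV n) → Set
P1 π = ∀ v w y → LinIndep v w →
  ¬ (π y ⊕ π (y ⊕ v) ⊕ π (y ⊕ w) ⊕ π (y ⊕ v ⊕ w) ≡ zeroV)

next : Fin 4 → Fin 4
next Fin.zero = Fin.suc Fin.zero
next (Fin.suc Fin.zero) = Fin.suc (Fin.suc Fin.zero)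
next (Fin.suc (Fin.suc Fin.zero)) = Fin.suc (Fin.suc (Fin.suc Fin.zero))
next (Fin.suc (Fin.suc (Fin.suc Fin.zero))) = Fin.zero

{-# OPTIONS --safe #-}
-- Write π y = α y^d.  Since d² ≡ 1 and α^(d+1) = 1, the map π is a permutation, with
-- inverse c ↦ α c^d.  Hence the Walsh values of fᵢ are ±2^m, with signs given by the
-- dual hᵢ (αᵢ c^d) + a · αᵢ c^d, and the sum of the four duals is 1 because Σ αᵢ = 0.  Four signs
-- with product −1 add up to ±2, so f is bent.
--
-- If f were in M#, it would have a subspace V of dimension m + 1 on which all second derivatives
-- vanish.  Let V₀ ⊆ V be the part in F × F, of dimension at least m − 1.  By P₁ the maps πᵢ are APN.
-- This forces first the projection of V₀ to the y-coordinate to have at most one nonzero value e, and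
-- then, as the derivative of π in direction e is not contained in a hyperplane, V₀ ⊆ F × 0.  So V
-- contains some (a , b , γ) with γ ≢ 0, and V₀ is annihilated by all α₀ y^d + α_γ (y + b)^d.  For b = 0
-- these are all of F; otherwise y = 0 and y = b give two distinct nonzero annihilators.  Neither is
-- possible for a space of dimension at least m − 1.
module Submission where

open import Defs
open import Algebra.Bundles using (CommutativeRing)
import Algebra.Properties.CommutativeMonoid.Sum
import Algebra.Solver.Ring
open import Algebra.Solver.Ring.AlmostCommutativeRing using (fromCommutativeRing; _-Raw-AlmostCommutative⟶_)
open import Data.Bool using (Bool; true; false; _xor_; _∧_; not)
open import Data.Bool.Properties using (xor-assoc; xor-comm; xor-same; xor-identityʳ; ∧-distribˡ-xor; ∧-zeroʳ; xor-∧-commutativeRing)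
import Data.Bool.Properties as Bool
open import Data.Bool.Solver using (module xor-∧-Solver)
open import Data.Empty using (⊥)
open import Data.Fin as Fin using (Fin; #_)
open import Data.Fin.Permutation using (permutation)
import Data.Fin.Properties as Fin
open import Data.Integer as ℤ using (ℤ)
import Data.Integer.Properties as ℤ
open import Data.Integer.Tactic.RingSolver using (solve-∀)
open import Data.List as List using (List)
import Data.List.Properties as List
open import Data.List.Membership.Propositional using (_∈_)
open import Data.List.Membership.Propositional.Properties using (∈-map⁺; ∈-map⁻; ∈-++⁺ˡ; ∈-++⁺ʳ)
open import Data.List.Membership.Propositional.Properties.WithK using (unique∧set⇒bag)
open import Data.List.Relation.Binary.BagAndSetEquality using (∼bag⇒↭)
open import Data.List.Relation.Binary.Permutation.Propositional using (_↭_; ↭⇒↭ₛ)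
import Data.List.Relation.Binary.Permutation.Setoid.Properties as Permutation
open import Data.List.Relation.Unary.All as All using (All; []; _∷_)
import Data.List.Relation.Unary.All.Properties as All
open import Data.List.Relation.Unary.AllPairs using ([]; _∷_)
open import Data.List.Relation.Unary.Any as Any using (here; there)
open import Data.List.Relation.Unary.Unique.Propositional using (Unique)
import Data.List.Relation.Unary.Unique.Propositional.Properties as Unique
open import Data.Maybe using (Maybe; just; nothing)
open import Data.Nat as N using (ℕ; zero; suc; _∸_; _^_; _≤_; _<_; s≤s; z≤n)
import Data.Nat.DivMod as N
open import Data.Nat.Divisibility using (_∣_; divides)
import Data.Nat.Properties as N
open import Data.Product using (Σ; _×_; _,_; ∃; ∃₂; proj₁; proj₂)
open import Data.Sum using (_⊎_; inj₁; inj₂)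
open import Data.Vec using (Vec; []; _∷_; _++_; take; drop; map; head; tail)
import Data.Vec.Properties as Vec
open import Function using (_∘_; Inverse; mk⇔)
open import Function.Definitions using (Bijective; Injective)
open import Relation.Binary.PropositionalEquality
open import Relation.Nullary using (¬_; yes; no; contradiction)
open import Relation.Nullary.Decidable using (dec-false)
open import Tactic.Cong using (cong!; ⌞_⌟)

-- Linear algebra over F₂

-- Membership in `InM#` quantifies over all affine permutations, so non-membership needs an
-- invariant. A function `x · π(y) + h(y)` is affine in x for fixed y, so its second derivatives
-- vanish along all pairs of directions (x , 0); an affine permutation transports these directions,
-- and an affine summand does not change second derivatives. A subspace is handled as an injective
-- additive map from some `BV k`, and upper bounds on dimensions become pigeonhole arguments about
-- such maps. Of the trace, both halves use only that it is additive and not identically zero, and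
-- they are carried out for an arbitrary functional `t` of this kind. The second property is a root
-- count: as a polynomial the trace has degree 2^(m-1), less than the size of the field. The form
-- `t (x * y)` is then nondegenerate and expresses every dot product of coordinate vectors, whatever
-- basis lies behind `coord`.

⊕-comm : ∀ {n} (u v : BV n) → u ⊕ v ≡ v ⊕ u
⊕-comm = Vec.zipWith-comm xor-comm

⊕-assoc : ∀ {n} (u v w : BV n) → u ⊕ v ⊕ w ≡ u ⊕ (v ⊕ w)
⊕-assoc = Vec.zipWith-assoc xor-assoc

⊕-identityˡ : ∀ {n} (v : BV n) → zeroV ⊕ v ≡ v
⊕-identityˡ = Vec.zipWith-identityˡ (λ _ → refl)

⊕-identityʳ : ∀ {n} (v : BV n) → v ⊕ zeroV ≡ v
⊕-identityʳ = Vec.zipWith-identityʳ xor-identityʳ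

⊕-self : ∀ {n} (v : BV n) → v ⊕ v ≡ zeroV
⊕-self []      = refl
⊕-self (b ∷ v) = cong₂ _∷_ (xor-same b) (⊕-self v)

⊕-cancelʳ : ∀ {n} (u v : BV n) → u ⊕ v ⊕ v ≡ u
⊕-cancelʳ u v = trans (⊕-assoc u v v) (trans (cong (u ⊕_) (⊕-self v)) (⊕-identityʳ u))

⊕≡0⇒≡ : ∀ {n} (u v : BV n) → u ⊕ v ≡ zeroV → u ≡ v
⊕≡0⇒≡ u v e = trans (sym (⊕-cancelʳ u v)) (trans (cong (_⊕ v) e) (⊕-identityˡ v))

⊕-interchange : ∀ {n} (a b c d : BV n) → (a ⊕ b) ⊕ (c ⊕ d) ≡ (a ⊕ c) ⊕ (b ⊕ d)
⊕-interchange a b c d = begin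
  (a ⊕ b) ⊕ (c ⊕ d)  ≡⟨ ⊕-assoc a b (c ⊕ d) ⟩
  a ⊕ (b ⊕ (c ⊕ d))  ≡⟨ cong (a ⊕_) (⊕-assoc b c d) ⟨
  a ⊕ (b ⊕ c ⊕ d)    ≡⟨ cong (λ t → a ⊕ (t ⊕ d)) (⊕-comm b c) ⟩
  a ⊕ (c ⊕ b ⊕ d)    ≡⟨ cong (a ⊕_) (⊕-assoc c b d) ⟩
  a ⊕ (c ⊕ (b ⊕ d))  ≡⟨ ⊕-assoc a c (b ⊕ d) ⟨
  (a ⊕ c) ⊕ (b ⊕ d)  ∎
  where open ≡-Reasoning

xor-interchange : ∀ a b c d → (a xor b) xor (c xor d) ≡ (a xor c) xor (b xor d)
xor-interchange a b c d = Vec.∷-injectiveˡ (⊕-interchange (a ∷ []) (b ∷ []) (c ∷ []) (d ∷ []))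

dot-⊕ʳ : ∀ {n} (a u v : BV n) → dot a (u ⊕ v) ≡ dot a u xor dot a v
dot-⊕ʳ []      []      []      = refl
dot-⊕ʳ (a ∷ as) (u ∷ us) (v ∷ vs) = begin
  (a ∧ (u xor v)) xor dot as (us ⊕ vs)
    ≡⟨ cong₂ _xor_ (∧-distribˡ-xor a u v) (dot-⊕ʳ as us vs) ⟩
  ((a ∧ u) xor (a ∧ v)) xor (dot as us xor dot as vs)
    ≡⟨ xor-interchange (a ∧ u) (a ∧ v) (dot as us) (dot as vs) ⟩
  ((a ∧ u) xor dot as us) xor ((a ∧ v) xor dot as vs) ∎
  where open ≡-Reasoning

dot-comm : ∀ {n} (u v : BV n) → dot u v ≡ dot v u
dot-comm []       []       = refl
dot-comm (a ∷ u) (b ∷ v) = cong₂ _xor_ (Bool.∧-comm a b) (dot-comm u v)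

dot-⊕ˡ : ∀ {n} (u v a : BV n) → dot (u ⊕ v) a ≡ dot u a xor dot v a
dot-⊕ˡ u v a = trans (dot-comm (u ⊕ v) a)
  (trans (dot-⊕ʳ a u v) (cong₂ _xor_ (dot-comm a u) (dot-comm a v)))

dot-++ : ∀ {n k} (a u : BV n) (b v : BV k) → dot (a ++ b) (u ++ v) ≡ dot a u xor dot b v
dot-++ []      []      b v = refl
dot-++ (x ∷ a) (y ∷ u) b v =
  trans (cong ((x ∧ y) xor_) (dot-++ a u b v)) (sym (xor-assoc (x ∧ y) (dot a u) (dot b v)))

matApply-⊕ : ∀ {n k} (M : Vec (BV n) k) (u v : BV n) →
             map (λ r → dot r (u ⊕ v)) M ≡ map (λ r → dot r u) M ⊕ map (λ r → dot r v) M
matApply-⊕ []      u v = refl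
matApply-⊕ (r ∷ M) u v = cong₂ _∷_ (dot-⊕ʳ r u v) (matApply-⊕ M u v)

take-⊕ : ∀ n {k} (u v : BV (n N.+ k)) → take n (u ⊕ v) ≡ take n u ⊕ take n v
take-⊕ n = Vec.take-zipWith {m = n} _xor_

drop-⊕ : ∀ n {k} (u v : BV (n N.+ k)) → drop n (u ⊕ v) ≡ drop n u ⊕ drop n v
drop-⊕ n = Vec.drop-zipWith {m = n} _xor_

take-++ : ∀ {n k} (u : BV n) (v : BV k) → take n (u ++ v) ≡ u
take-++ {n} u v = Vec.++-injectiveˡ (take n (u ++ v)) u (Vec.take++drop≡id n (u ++ v))

drop-++ : ∀ {n k} (u : BV n) (v : BV k) → drop n (u ++ v) ≡ v
drop-++ {n} u v = Vec.++-injectiveʳ (take n (u ++ v)) u (Vec.take++drop≡id n (u ++ v))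

take-drop-injective : ∀ n {k} (u v : BV (n N.+ k)) → take n u ≡ take n v → drop n u ≡ drop n v → u ≡ v
take-drop-injective n u v p q =
  trans (sym (Vec.take++drop≡id n u)) (trans (cong₂ _++_ p q) (Vec.take++drop≡id n v))

-- Additive maps and parametrised subspaces

Additive : ∀ {n k} → (BV n → BV k) → Set
Additive f = ∀ u v → f (u ⊕ v) ≡ f u ⊕ f v

Linear : ∀ {n} → (BV n → Bool) → Set
Linear L = ∀ u v → L (u ⊕ v) ≡ L u xor L v

linear-zeroV : ∀ {n} (L : BV n → Bool) → Linear L → L zeroV ≡ false
linear-zeroV L lin = trans (trans (cong L (sym (⊕-self zeroV))) (lin zeroV zeroV)) (xor-same (L zeroV))

linear-∷ : ∀ {n} (L : BV (suc n) → Bool) → Linear L → ∀ b v →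
           L (b ∷ v) ≡ (b ∧ L (true ∷ zeroV)) xor L (false ∷ v)
linear-∷ L lin false v = refl
linear-∷ L lin true  v =
  trans (cong (λ w → L (true ∷ w)) (sym (⊕-identityˡ v))) (lin (true ∷ zeroV) (false ∷ v))

-- The image lies in `P` but need not exhaust it: only a lower bound on the dimension is recorded.
record Subspace {n} (k : ℕ) (P : BV n → Set) : Set where
  field
    embed     : BV k → BV n
    injective : ∀ u v → embed u ≡ embed v → u ≡ v
    additive  : Additive embed
    inside    : ∀ u → P (embed u)

-- If the first unit vector lies outside the kernel, the first coordinate is determined by the
-- others. Otherwise it is free and the recursion continues with the rest. For `L` identically zero
-- it ends in the case `zero`, where one dimension is given up so that the count is uniform.
kernel : ∀ {n} (L : BV (suc n) → Bool) → Linear L → Subspace n (λ v → L v ≡ false)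
kernel {n} L lin with L (true ∷ zeroV) in L₀
... | true  = record
  { embed     = λ v → L (false ∷ v) ∷ v
  ; injective = λ u v → Vec.∷-injectiveʳ
  ; additive  = λ u v → cong (_∷ (u ⊕ v)) (lin (false ∷ u) (false ∷ v))
  ; inside    = λ v → trans (linear-∷ L lin (L (false ∷ v)) v)
      (trans (cong (λ b → (L (false ∷ v) ∧ b) xor L (false ∷ v)) L₀)
        (trans (cong (_xor L (false ∷ v)) (Bool.∧-identityʳ (L (false ∷ v)))) (xor-same (L (false ∷ v)))))
  }
kernel {zero} L lin | false = record
  { embed     = λ _ → zeroV
  ; injective = λ { [] [] _ → refl }
  ; additive  = λ _ _ → refl
  ; inside    = λ _ → linear-zeroV L lin
  }
kernel {suc n} L lin | false = record
  { embed     = λ { (b ∷ v) → b ∷ embed v }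
  ; injective = λ { (a ∷ u) (b ∷ v) e →
      cong₂ _∷_ (Vec.∷-injectiveˡ e) (injective u v (Vec.∷-injectiveʳ e)) }
  ; additive  = λ { (a ∷ u) (b ∷ v) → cong ((a xor b) ∷_) (additive u v) }
  ; inside    = λ { (b ∷ v) → trans (linear-∷ L lin b (embed v))
      (trans (cong₂ (λ c d → (b ∧ c) xor d) L₀ (inside v)) (trans (xor-identityʳ (b ∧ false)) (∧-zeroʳ b))) }
  }
  where open Subspace (kernel (L ∘ (false ∷_)) (λ u v → lin (false ∷ u) (false ∷ v)))

-- Each bit of `C` costs one dimension: the kernel of the second bit is taken inside that of the
-- first.
kernel₂ : ∀ {n} (C : BV (suc (suc n)) → BV 2) → Additive C → Subspace n (λ v → C v ≡ zeroV)
kernel₂ {n} C add = record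
  { embed     = K.embed ∘ K′.embed
  ; injective = λ u v e → K′.injective u v (K.injective _ _ e)
  ; additive  = λ u v → trans (cong K.embed (K′.additive u v)) (K.additive _ _)
  ; inside    = λ u → two (C (K.embed (K′.embed u))) (K.inside (K′.embed u)) (K′.inside u)
  }
  where
  two : (v : BV 2) → head v ≡ false → head (tail v) ≡ false → v ≡ zeroV
  two (_ ∷ _ ∷ []) refl refl = refl
  head-⊕ : ∀ {n} (u v : BV (suc n)) → head (u ⊕ v) ≡ head u xor head v
  head-⊕ (_ ∷ _) (_ ∷ _) = refl
  tail-⊕ : ∀ {n} (u v : BV (suc n)) → tail (u ⊕ v) ≡ tail u ⊕ tail v
  tail-⊕ (_ ∷ _) (_ ∷ _) = refl
  module K = Subspace (kernel (head ∘ C) (λ u v → trans (cong head (add u v)) (head-⊕ (C u) (C v))))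
  module K′ = Subspace (kernel (head ∘ tail ∘ C ∘ K.embed) (λ u v →
    trans (cong (head ∘ tail) (trans (cong C (K.additive u v)) (add _ _)))
      (trans (cong head (tail-⊕ (C (K.embed u)) (C (K.embed v)))) (head-⊕ (tail (C (K.embed u))) (tail (C (K.embed v)))))))

-- Counting bit vectors: pigeonhole principle and its consequences

open Inverse Fin.2↔Bool using () renaming (to to toBool; from to fromBool; strictlyInverseˡ to toBool-fromBool; strictlyInverseʳ to fromBool-toBool)

toFin : ∀ {n} → BV n → Fin (2 ^ n)
toFin []      = Fin.zero
toFin (b ∷ v) = Fin.combine (fromBool b) (toFin v)

fromFin : ∀ {n} → Fin (2 ^ n) → BV n
fromFin {zero}  i = []
fromFin {suc n} i = toBool (proj₁ (Fin.remQuot {2} (2 ^ n) i)) ∷ fromFin (proj₂ (Fin.remQuot {2} (2 ^ n) i))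

fromFin-toFin : ∀ {n} (v : BV n) → fromFin (toFin v) ≡ v
fromFin-toFin []      = refl
fromFin-toFin (b ∷ v) = cong₂ _∷_
  (trans (cong (toBool ∘ proj₁) (Fin.remQuot-combine (fromBool b) (toFin v))) (toBool-fromBool b))
  (trans (cong (fromFin ∘ proj₂) (Fin.remQuot-combine (fromBool b) (toFin v))) (fromFin-toFin v))

toFin-fromFin : ∀ {n} (i : Fin (2 ^ n)) → toFin (fromFin {n} i) ≡ i
toFin-fromFin {zero}  Fin.zero = refl
toFin-fromFin {suc n} i =
  trans (cong₂ Fin.combine (fromBool-toBool (proj₁ (Fin.remQuot {2} (2 ^ n) i))) (toFin-fromFin {n} (proj₂ (Fin.remQuot {2} (2 ^ n) i))))
        (Fin.combine-remQuot {2} (2 ^ n) i)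

toFin-injective : ∀ {n} {u v : BV n} → toFin u ≡ toFin v → u ≡ v
toFin-injective {u = u} {v} e = trans (sym (fromFin-toFin u)) (trans (cong fromFin e) (fromFin-toFin v))

fromFin-injective : ∀ {n} {i j : Fin (2 ^ n)} → fromFin {n} i ≡ fromFin j → i ≡ j
fromFin-injective {n} {i} {j} e = trans (sym (toFin-fromFin {n} i)) (trans (cong toFin e) (toFin-fromFin {n} j))

collision : ∀ {n} (f : BV (suc n) → BV n) → ∃₂ λ u v → ¬ u ≡ v × f u ≡ f v
collision {n} f
  with i , j , i<j , e ← Fin.pigeonhole (N.^-monoʳ-< 2 (s≤s (s≤s z≤n)) (N.n<1+n n)) (toFin ∘ f ∘ fromFin)
  = fromFin i , fromFin j , (λ q → Fin.<⇒≢ i<j (fromFin-injective {suc n} q)) , toFin-injective e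

fin-injective⇒surjective : ∀ {n} (f : Fin n → Fin n) → Injective _≡_ _≡_ f → ∀ y → ∃ λ x → f x ≡ y
fin-injective⇒surjective {suc n} f inj y with Fin.any? (λ x → f x Fin.≟ y)
... | yes p = p
-- If `y` is missed, deleting it from the range leaves a map into a set with one element fewer.
... | no ¬p
  with i , j , i<j , e ← Fin.pigeonhole (N.n<1+n n) (λ x → Fin.punchOut {i = y} {j = f x} (λ q → ¬p (x , sym q)))
  = contradiction (inj (Fin.punchOut-injective (λ q → ¬p (i , sym q)) (λ q → ¬p (j , sym q)) e)) (Fin.<⇒≢ i<j)

injective⇒surjective : ∀ {n} (f : BV n → BV n) → (∀ u v → f u ≡ f v → u ≡ v) → ∀ y → ∃ λ x → f x ≡ y
injective⇒surjective {n} f inj y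
  with i , e ← fin-injective⇒surjective (toFin ∘ f ∘ fromFin {n}) (λ e → fromFin-injective {n} (inj _ _ (toFin-injective e))) (toFin y)
  = fromFin i , toFin-injective e

coefficients : ∀ {n} → (BV n → Bool) → BV n
coefficients {zero}  L = []
coefficients {suc n} L = L (true ∷ zeroV) ∷ coefficients (L ∘ (false ∷_))

dot-coefficients : ∀ {n} (L : BV n → Bool) → Linear L → ∀ v → dot (coefficients L) v ≡ L v
dot-coefficients L lin []      = sym (linear-zeroV L lin)
dot-coefficients L lin (b ∷ v) = begin
  (L (true ∷ zeroV) ∧ b) xor dot (coefficients (L ∘ (false ∷_))) v
    ≡⟨ cong₂ _xor_ (Bool.∧-comm (L (true ∷ zeroV)) b)
         (dot-coefficients (L ∘ (false ∷_)) (λ u v → lin (false ∷ u) (false ∷ v)) v) ⟩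
  (b ∧ L (true ∷ zeroV)) xor L (false ∷ v)
    ≡⟨ linear-∷ L lin b v ⟨
  L (b ∷ v) ∎
  where open ≡-Reasoning

-- Finite fields of characteristic 2

∈-allVec : ∀ {n} (v : BV n) → v ∈ allVec n
∈-allVec []          = here refl
∈-allVec (false ∷ v) = ∈-++⁺ˡ (∈-map⁺ (false ∷_) (∈-allVec v))
∈-allVec (true ∷ v)  = ∈-++⁺ʳ _ (∈-map⁺ (true ∷_) (∈-allVec v))

allVec-unique : ∀ n → Unique (allVec n)
allVec-unique zero    = [] ∷ []
allVec-unique (suc n) = Unique.++⁺ (Unique.map⁺ Vec.∷-injectiveʳ (allVec-unique n)) (Unique.map⁺ Vec.∷-injectiveʳ (allVec-unique n))
  λ { (p , q) → case (∈-map⁻ (false ∷_) p) (∈-map⁻ (true ∷_) q) }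
  where
  case : ∀ {v : BV (suc n)} → (∃ λ x → x ∈ allVec n × v ≡ false ∷ x) → ¬ (∃ λ x → x ∈ allVec n × v ≡ true ∷ x)
  case (_ , _ , refl) (_ , _ , ())

length-allVec : ∀ n → List.length (allVec n) ≡ 2 ^ n
length-allVec zero    = refl
length-allVec (suc n) = begin
  List.length (List.map (false ∷_) (allVec n) List.++ List.map (true ∷_) (allVec n))
    ≡⟨ List.length-++ (List.map (false ∷_) (allVec n)) ⟩
  List.length (List.map (false ∷_) (allVec n)) N.+ List.length (List.map (true ∷_) (allVec n))
    ≡⟨ cong₂ N._+_ (trans (List.length-map (false ∷_) (allVec n)) (length-allVec n)) (trans (List.length-map (true ∷_) (allVec n)) (trans (length-allVec n) (sym (N.+-identityʳ (2 ^ n))))) ⟩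
  2 ^ suc n ∎
  where open ≡-Reasoning

-- This lets the nonzero elements of the field be listed as a tail, without filtering.
allVec-head : ∀ n → ∃ λ r → allVec n ≡ zeroV List.∷ r
allVec-head zero    = List.[] , refl
allVec-head (suc n) with allVec-head n
... | r , e = _ , cong (λ l → List.map (false ∷_) l List.++ List.map (true ∷_) (allVec n)) e

module Field {m} (F : GF2^ m) where
  open GF2^ F public

  ring : CommutativeRing _ _
  ring = record { isCommutativeRing = isCommutativeRing }

  open CommutativeRing ring public using (+-identityˡ; +-identityʳ; *-identityˡ; *-identityʳ; zeroˡ; zeroʳ; *-assoc; *-comm; +-assoc; distribˡ; distribʳ; *-isCommutativeMonoid)

  coord-injective : ∀ {x y} → coord x ≡ coord y → x ≡ y
  coord-injective {x} {y} e = trans (sym (uncoord-coord x)) (trans (cong uncoord e) (uncoord-coord y))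

  uncoord-injective : ∀ {u v} → uncoord u ≡ uncoord v → u ≡ v
  uncoord-injective {u} {v} e = trans (sym (coord-uncoord u)) (trans (cong coord e) (coord-uncoord v))

  coord-0 : coord 0# ≡ zeroV
  coord-0 = begin
    coord 0#                        ≡⟨ ⊕-cancelʳ (coord 0#) (coord 0#) ⟨
    coord 0# ⊕ coord 0# ⊕ coord 0#  ≡⟨ cong (_⊕ coord 0#) (coord-+ 0# 0#) ⟨
    coord (0# + 0#) ⊕ coord 0#      ≡⟨ cong (λ x → coord x ⊕ coord 0#) (+-identityˡ 0#) ⟩
    coord 0# ⊕ coord 0#             ≡⟨ ⊕-self (coord 0#) ⟩
    zeroV                           ∎
    where open ≡-Reasoning

  uncoord-zeroV : uncoord zeroV ≡ 0#
  uncoord-zeroV = trans (cong uncoord (sym coord-0)) (uncoord-coord 0#)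

  uncoord-⊕ : ∀ u v → uncoord (u ⊕ v) ≡ uncoord u + uncoord v
  uncoord-⊕ u v = begin
    uncoord (u ⊕ v)                                  ≡⟨ cong₂ (λ a b → uncoord (a ⊕ b)) (coord-uncoord u) (coord-uncoord v) ⟨
    uncoord (coord (uncoord u) ⊕ coord (uncoord v))  ≡⟨ cong uncoord (coord-+ (uncoord u) (uncoord v)) ⟨
    uncoord (coord (uncoord u + uncoord v))          ≡⟨ uncoord-coord _ ⟩
    uncoord u + uncoord v                            ∎
    where open ≡-Reasoning

  x+x≡0 : ∀ x → x + x ≡ 0#
  x+x≡0 x = coord-injective (trans (coord-+ x x) (trans (⊕-self (coord x)) (sym coord-0)))

  ⟦_⟧ : Bool → Carrier
  ⟦ false ⟧ = 0#
  ⟦ true ⟧  = 1#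

  ⟦⟧-xor : ∀ a b → ⟦ a xor b ⟧ ≡ ⟦ a ⟧ + ⟦ b ⟧
  ⟦⟧-xor false b     = sym (+-identityˡ ⟦ b ⟧)
  ⟦⟧-xor true  false = sym (+-identityʳ 1#)
  ⟦⟧-xor true  true  = sym (x+x≡0 1#)

  ⟦⟧-∧ : ∀ a b → ⟦ a ∧ b ⟧ ≡ ⟦ a ⟧ * ⟦ b ⟧
  ⟦⟧-∧ false b = sym (zeroˡ ⟦ b ⟧)
  ⟦⟧-∧ true  b = sym (*-identityˡ ⟦ b ⟧)

  -x≡x : ∀ x → - x ≡ x
  -x≡x x = begin
    - x            ≡⟨ +-identityʳ (- x) ⟨
    - x + 0#       ≡⟨ cong (- x +_) (x+x≡0 x) ⟨
    - x + (x + x)  ≡⟨ +-assoc (- x) x x ⟨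
    (- x + x) + x  ≡⟨ cong (_+ x) (CommutativeRing.-‿inverseˡ ring x) ⟩
    0# + x         ≡⟨ +-identityˡ x ⟩
    x              ∎
    where open ≡-Reasoning

  embedding : CommutativeRing.rawRing xor-∧-commutativeRing -Raw-AlmostCommutative⟶ fromCommutativeRing ring
  embedding = record
    { ⟦_⟧    = ⟦_⟧
    ; +-homo = ⟦⟧-xor
    ; *-homo = ⟦⟧-∧
    ; -‿homo = λ a → sym (-x≡x ⟦ a ⟧)
    ; 0-homo = refl
    ; 1-homo = refl
    }

  equal-coefficients : ∀ a b → Maybe (⟦ a ⟧ ≡ ⟦ b ⟧)
  equal-coefficients false false = just refl
  equal-coefficients true  true  = just refl
  equal-coefficients _     _     = nothing

  -- With coefficients in F₂ the ring solver knows that the characteristic is 2.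
  module Solver = Algebra.Solver.Ring (CommutativeRing.rawRing xor-∧-commutativeRing) (fromCommutativeRing ring) embedding equal-coefficients
  open Solver using (solve; _:+_; _:*_; _:=_; con)

  +≡0⇒≡ : ∀ {x y} → x + y ≡ 0# → x ≡ y
  +≡0⇒≡ {x} {y} e = trans (solve 2 (λ x y → x := (x :+ y) :+ y) refl x y) (trans (cong (_+ y) e) (+-identityˡ y))

  ≢⇒+≢0 : ∀ {x y} → ¬ x ≡ y → ¬ x + y ≡ 0#
  ≢⇒+≢0 n e = n (+≡0⇒≡ e)

  *-cancelˡ : ∀ x {y z} → ¬ x ≡ 0# → x * y ≡ x * z → y ≡ z
  *-cancelˡ x {y} {z} n e = trans (sym (inv-* y)) (trans (cong (inv x *_) e) (inv-* z))
    where
    inv-* : ∀ y → inv x * (x * y) ≡ y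
    inv-* y = trans (solve 3 (λ i x y → i :* (x :* y) := (x :* i) :* y) refl (inv x) x y)
                    (trans (cong (_* y) (inv-r x n)) (*-identityˡ y))

  *-≢0 : ∀ {x y} → ¬ x ≡ 0# → ¬ y ≡ 0# → ¬ x * y ≡ 0#
  *-≢0 {x} nx ny e = ny (*-cancelˡ x nx (trans e (sym (zeroʳ x))))

  inv-cancel : ∀ x y → ¬ x ≡ 0# → x * (inv x * y) ≡ y
  inv-cancel x y n = trans (sym (*-assoc x (inv x) y)) (trans (cong (_* y) (inv-r x n)) (*-identityˡ y))

  ^-+ : ∀ x a b → x ^ᶠ (a N.+ b) ≡ (x ^ᶠ a) * (x ^ᶠ b)
  ^-+ x zero    b = sym (*-identityˡ _)
  ^-+ x (suc a) b = trans (cong (x *_) (^-+ x a b)) (sym (*-assoc x _ _))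

  *-^ : ∀ x y a → (x * y) ^ᶠ a ≡ (x ^ᶠ a) * (y ^ᶠ a)
  *-^ x y zero    = sym (*-identityˡ 1#)
  *-^ x y (suc a) = trans (cong (x * y *_) (*-^ x y a))
    (solve 4 (λ x y p q → (x :* y) :* (p :* q) := (x :* p) :* (y :* q)) refl x y (x ^ᶠ a) (y ^ᶠ a))

  ^-* : ∀ x a b → x ^ᶠ (a N.* b) ≡ (x ^ᶠ b) ^ᶠ a
  ^-* x zero    b = refl
  ^-* x (suc a) b = trans (^-+ x b (a N.* b)) (cong ((x ^ᶠ b) *_) (^-* x a b))

  1^ : ∀ a → 1# ^ᶠ a ≡ 1#
  1^ zero    = refl
  1^ (suc a) = trans (*-identityˡ _) (1^ a)

  0^ : ∀ {a} → 1 ≤ a → 0# ^ᶠ a ≡ 0#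
  0^ {suc a} _ = zeroˡ _

  ^≢0 : ∀ {x} a → ¬ x ≡ 0# → ¬ x ^ᶠ a ≡ 0#
  ^≢0 zero    n = 1≢0
  ^≢0 (suc a) n = *-≢0 n (^≢0 a n)

  -- Fermat's little theorem and the Frobenius map

  elements nonzeros : List Carrier
  elements = List.map uncoord (allVec m)
  nonzeros = List.map uncoord (proj₁ (allVec-head m))

  elements-split : elements ≡ 0# List.∷ nonzeros
  elements-split = trans (cong (List.map uncoord) (proj₂ (allVec-head m))) (cong (List._∷ nonzeros) uncoord-zeroV)

  elements-unique : Unique elements
  elements-unique = Unique.map⁺ uncoord-injective (allVec-unique m)

  length-elements : List.length elements ≡ 2 ^ m
  length-elements = trans (List.length-map uncoord (allVec m)) (length-allVec m)

  ∈-elements : ∀ x → x ∈ elements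
  ∈-elements x = subst (_∈ elements) (uncoord-coord x) (∈-map⁺ uncoord (∈-allVec (coord x)))

  nonzeros-spec : All (λ x → ¬ 0# ≡ x) nonzeros × Unique nonzeros
  nonzeros-spec with subst Unique elements-split elements-unique
  ... | p ∷ q = p , q

  ∈-nonzeros : ∀ {x} → ¬ x ≡ 0# → x ∈ nonzeros
  ∈-nonzeros {x} n with subst (x ∈_) elements-split (∈-elements x)
  ... | here e  = contradiction e n
  ... | there p = p

  length-nonzeros : List.length nonzeros ≡ 2 ^ m ∸ 1
  length-nonzeros = cong (_∸ 1) (trans (cong List.length (sym elements-split)) length-elements)

  product : List Carrier → Carrier
  product = List.foldr _*_ 1#

  product-map : ∀ x ys → product (List.map (x *_) ys) ≡ (x ^ᶠ List.length ys) * product ys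
  product-map x List.[]       = sym (*-identityˡ 1#)
  product-map x (y List.∷ ys) = trans (cong (x * y *_) (product-map x ys))
    (solve 4 (λ x y p q → (x :* y) :* (p :* q) := (x :* p) :* (y :* q)) refl x y (x ^ᶠ List.length ys) (product ys))

  product-≢0 : ∀ {ys} → All (λ y → ¬ 0# ≡ y) ys → ¬ product ys ≡ 0#
  product-≢0 []       = 1≢0
  product-≢0 (p ∷ ps) = *-≢0 (p ∘ sym) (product-≢0 ps)

  -- Duplicate-free lists with the same members are permutations of each other, and division by `x`
  -- shows that the members agree.
  scale-nonzeros : ∀ {x} → ¬ x ≡ 0# → List.map (x *_) nonzeros ↭ nonzeros
  scale-nonzeros {x} n = ∼bag⇒↭ (unique∧set⇒bag (Unique.map⁺ (*-cancelˡ x n) (proj₂ nonzeros-spec)) (proj₂ nonzeros-spec) (mk⇔ to from))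
    where
    to : ∀ {z} → z ∈ List.map (x *_) nonzeros → z ∈ nonzeros
    to p with y , y∈ , refl ← ∈-map⁻ (x *_) p = ∈-nonzeros (*-≢0 n (All.lookup (proj₁ nonzeros-spec) y∈ ∘ sym))
    from : ∀ {z} → z ∈ nonzeros → z ∈ List.map (x *_) nonzeros
    from {z} p = subst (_∈ List.map (x *_) nonzeros) (inv-cancel x z n)
      (∈-map⁺ (x *_) (∈-nonzeros λ e → All.lookup (proj₁ nonzeros-spec) p (sym (trans (sym (inv-cancel x z n)) (trans (cong (x *_) e) (zeroʳ x))))))

  -- Multiplication by `x` permutes the nonzero elements, so their product `P` is unchanged when
  -- every factor is multiplied by `x`. It remains to cancel `P`.
  fermat : ∀ {x} → ¬ x ≡ 0# → x ^ᶠ (2 ^ m ∸ 1) ≡ 1#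
  fermat {x} n = *-cancelˡ P (product-≢0 (proj₁ nonzeros-spec)) (begin
    P * (x ^ᶠ (2 ^ m ∸ 1))                 ≡⟨ *-comm P _ ⟩
    (x ^ᶠ (2 ^ m ∸ 1)) * P                 ≡⟨ cong (λ k → (x ^ᶠ k) * P) length-nonzeros ⟨
    (x ^ᶠ List.length nonzeros) * P        ≡⟨ product-map x nonzeros ⟨
    product (List.map (x *_) nonzeros)   ≡⟨ Permutation.foldr-commMonoid (setoid Carrier) *-isCommutativeMonoid (↭⇒↭ₛ (scale-nonzeros n)) ⟩
    P                                    ≡⟨ *-identityʳ P ⟨
    P * 1#                               ∎)
    where
    open ≡-Reasoning
    P = product nonzeros

  -- The exponent is positive so that the identity also holds at 0, where Fermat's theorem says
  -- nothing.
  ^-mod : ∀ {e} → 1 ≤ e → (2 ^ m ∸ 1) ∣ (e ∸ 1) → ∀ x → x ^ᶠ e ≡ x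
  ^-mod {suc e} _ (divides q refl) x with x ≟ 0#
  ... | yes refl = zeroˡ _
  ... | no n     = trans (cong (x *_) (trans (^-* x q _) (trans (cong (_^ᶠ q) (fermat n)) (1^ q)))) (*-identityʳ x)

  x^2^m≡x : ∀ x → x ^ᶠ (2 ^ m) ≡ x
  x^2^m≡x = ^-mod (N.m^n>0 2 m) (divides 1 (sym (N.+-identityʳ _)))

  frobenius : ∀ i x y → (x + y) ^ᶠ (2 ^ i) ≡ (x ^ᶠ (2 ^ i)) + (y ^ᶠ (2 ^ i))
  frobenius zero    x y = solve 2 (λ x y → (x :+ y) :* con true := x :* con true :+ y :* con true) refl x y
  frobenius (suc i) x y = begin
    (x + y) ^ᶠ (2 ^ suc i)                          ≡⟨ double (x + y) ⟩
    ((x + y) ^ᶠ 2) ^ᶠ (2 ^ i)                       ≡⟨ cong (_^ᶠ (2 ^ i)) (solve 2 (λ x y → (x :+ y) :* ((x :+ y) :* con true) := x :* (x :* con true) :+ y :* (y :* con true)) refl x y) ⟩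
    ((x ^ᶠ 2) + (y ^ᶠ 2)) ^ᶠ (2 ^ i)                ≡⟨ frobenius i (x ^ᶠ 2) (y ^ᶠ 2) ⟩
    ((x ^ᶠ 2) ^ᶠ (2 ^ i)) + ((y ^ᶠ 2) ^ᶠ (2 ^ i))   ≡⟨ cong₂ _+_ (double x) (double y) ⟨
    (x ^ᶠ (2 ^ suc i)) + (y ^ᶠ (2 ^ suc i))         ∎
    where
    open ≡-Reasoning
    double : ∀ z → z ^ᶠ (2 ^ suc i) ≡ (z ^ᶠ 2) ^ᶠ (2 ^ i)
    double z = trans (cong (z ^ᶠ_) (N.*-comm 2 (2 ^ i))) (^-* z (2 ^ i) 2)

  -- Partial traces and the number of roots of a polynomial

  partialTrace : Carrier → ℕ → Carrier
  partialTrace x zero    = 0#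
  partialTrace x (suc i) = (x ^ᶠ (2 ^ i)) + partialTrace x i

  partialTrace-+ : ∀ x y n → partialTrace (x + y) n ≡ partialTrace x n + partialTrace y n
  partialTrace-+ x y zero    = sym (+-identityˡ 0#)
  partialTrace-+ x y (suc n) = trans (cong₂ _+_ (frobenius n x y) (partialTrace-+ x y n))
    (solve 4 (λ a b c d → (a :+ b) :+ (c :+ d) := (a :+ c) :+ (b :+ d)) refl _ _ _ _)

  -- Squaring shifts the sum x + x² + x⁴ + ... by one position, so only the end terms x and x^(2^n)
  -- change. For n = m these cancel, which makes the trace idempotent.
  partialTrace-square : ∀ x n → partialTrace x n * partialTrace x n ≡ (x ^ᶠ (2 ^ n)) + x + partialTrace x n
  partialTrace-square x zero    = solve 1 (λ x → con false :* con false := x :* con true :+ x :+ con false) refl x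
  partialTrace-square x (suc n) = begin
    (p + t) * (p + t)          ≡⟨ solve 2 (λ p t → (p :+ t) :* (p :+ t) := p :* p :+ t :* t) refl p t ⟩
    p * p + t * t              ≡⟨ cong₂ _+_ (sym square) (partialTrace-square x n) ⟩
    q + (p + x + t)            ≡⟨ solve 4 (λ p t q x → q :+ (p :+ x :+ t) := q :+ x :+ (p :+ t)) refl p t q x ⟩
    q + x + (p + t)            ∎
    where
    open ≡-Reasoning
    p = x ^ᶠ (2 ^ n)
    q = x ^ᶠ (2 ^ suc n)
    t = partialTrace x n
    square : q ≡ p * p
    square = trans (cong (x ^ᶠ_) (cong (2 ^ n N.+_) (N.+-identityʳ (2 ^ n)))) (^-+ x (2 ^ n) (2 ^ n))

  -- Polynomial functions of formal degree n with leading coefficient ℓ.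
  data Poly (ℓ : Carrier) : ℕ → (Carrier → Carrier) → Set where
    const : ∀ {f} → (∀ x → f x ≡ ℓ) → Poly ℓ 0 f
    step  : ∀ {n f} c g → (∀ x → f x ≡ c + x * g x) → Poly ℓ n g → Poly ℓ (suc n) f

  poly-+ : ∀ {ℓ ℓ′ n f f′} → Poly ℓ n f → Poly ℓ′ n f′ → Poly (ℓ + ℓ′) n (λ x → f x + f′ x)
  poly-+ (const e)      (const e′)         = const λ x → cong₂ _+_ (e x) (e′ x)
  poly-+ (step c g e p) (step c′ g′ e′ p′) = step (c + c′) (λ x → g x + g′ x)
    (λ x → trans (cong₂ _+_ (e x) (e′ x))
      (solve 5 (λ c c′ x y y′ → (c :+ x :* y) :+ (c′ :+ x :* y′) := (c :+ c′) :+ x :* (y :+ y′)) refl c c′ x (g x) (g′ x)))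
    (poly-+ p p′)

  -- Raising the formal degree makes the leading coefficient 0; this pads summands of lower degree
  -- for `poly-+`.
  poly-suc : ∀ {ℓ n f} → Poly ℓ n f → Poly 0# (suc n) f
  poly-suc {ℓ} (const e)      = step ℓ (λ _ → 0#) (λ x → trans (e x) (solve 2 (λ l x → l := l :+ x :* con false) refl ℓ x)) (const λ _ → refl)
  poly-suc     (step c g e p) = step c g e (poly-suc p)

  poly-< : ∀ {ℓ n k f} → n N.<′ k → Poly ℓ n f → Poly 0# k f
  poly-< N.<′-base     p = poly-suc p
  poly-< (N.≤′-step l) p = poly-suc (poly-< l p)

  poly-^ : ∀ n → Poly 1# n (_^ᶠ n)
  poly-^ zero    = const λ _ → refl
  poly-^ (suc n) = step 0# (_^ᶠ n) (λ x → sym (+-identityˡ _)) (poly-^ n)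

  -- The last summand x^(2^n) is monic, and the earlier ones have smaller degree and are padded.
  poly-partialTrace : ∀ n → Poly 1# (2 ^ n) (λ x → partialTrace x (suc n))
  poly-partialTrace zero    = step 0# (λ _ → 1#) (λ x → solve 1 (λ x → x :* con true :+ con false := con false :+ x :* con true) refl x) (const λ _ → refl)
  poly-partialTrace (suc n) = subst (λ ℓ → Poly ℓ (2 ^ suc n) (λ x → partialTrace x (suc (suc n)))) (+-identityʳ 1#)
    (poly-+ (poly-^ (2 ^ suc n)) (poly-< (N.<⇒<′ (N.^-monoʳ-< 2 (s≤s (s≤s z≤n)) (N.n<1+n n))) (poly-partialTrace n)))

  -- Horner division by x - a, which is x + a in characteristic 2. The quotient keeps the leading
  -- coefficient.
  quotient : ∀ {ℓ n f} → Poly ℓ (suc n) f → ∀ a → ∃ λ q → Poly ℓ n q × (∀ x → f x ≡ f a + (x + a) * q x)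
  quotient {ℓ} {f = f} (step c g e (const e′)) a = (λ _ → ℓ) , const (λ _ → refl) , λ x → begin
    f x                        ≡⟨ trans (e x) (cong (λ y → c + x * y) (e′ x)) ⟩
    c + x * ℓ                  ≡⟨ solve 4 (λ c x a l → c :+ x :* l := (c :+ a :* l) :+ (x :+ a) :* l) refl c x a ℓ ⟩
    c + a * ℓ + (x + a) * ℓ    ≡⟨ cong (_+ (x + a) * ℓ) (trans (e a) (cong (λ y → c + a * y) (e′ a))) ⟨
    f a + (x + a) * ℓ          ∎
    where open ≡-Reasoning
  quotient {f = f} (step c g e p@(step _ _ _ _)) a with q , pq , h ← quotient p a =
    (λ x → g a + x * q x) , step (g a) q (λ _ → refl) pq , λ x → begin
    f x                                      ≡⟨ trans (e x) (cong (λ y → c + x * y) (h x)) ⟩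
    c + x * (g a + (x + a) * q x)            ≡⟨ solve 5 (λ c x a y z → c :+ x :* (y :+ (x :+ a) :* z) := (c :+ a :* y) :+ (x :+ a) :* (y :+ x :* z)) refl c x a (g a) (q x) ⟩
    c + a * g a + (x + a) * (g a + x * q x)  ≡⟨ cong (_+ (x + a) * (g a + x * q x)) (e a) ⟨
    f a + (x + a) * (g a + x * q x)          ∎
    where open ≡-Reasoning

  -- After one root is divided off, the others are roots of the quotient, because `x + a` is nonzero
  -- for `x` different from `a`.
  root-bound : ∀ {ℓ n f} → ¬ ℓ ≡ 0# → Poly ℓ n f → ∀ xs → Unique xs → n < List.length xs → ¬ All (λ x → f x ≡ 0#) xs
  root-bound nz (const e) (x List.∷ xs) _ _ (r ∷ _) = nz (trans (sym (e x)) r)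
  root-bound {f = f} nz p@(step _ _ _ _) (a List.∷ xs) (a∉ ∷ u) (s≤s l) (r ∷ rs)
    with q , pq , h ← quotient p a =
    root-bound nz pq xs u l (All.zipWith (λ { {x} (x≢a , fx) → quotient-root x≢a fx }) (a∉ , rs))
    where
    quotient-root : ∀ {x} → ¬ a ≡ x → f x ≡ 0# → q x ≡ 0#
    quotient-root {x} n fx = *-cancelˡ (x + a) (≢⇒+≢0 (n ∘ sym))
      (trans (sym (trans (h x) (trans (cong (_+ (x + a) * q x) r) (+-identityˡ _)))) (trans fx (sym (zeroʳ (x + a)))))

-- The summation loop inside Tr is a local function without a name in scope.  To
-- reason about it we recover it as a function of its counter, by letting cong!
-- abstract the marked counter while the parameter m of the field stays fixed.
-- Box blocks reduction, so that m is not unfolded along with the counter.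

data Box : Set where
  box : ℕ → Box

unbox : Box → ℕ
unbox (box n) = n

markedSuc : (Box → ℕ) → Box → ℕ
markedSuc h (box n) = suc (h (box ⌞ n ⌟))

-- The endpoints are hidden so that a proof of `s ≡ s` can be compared with `cong loop e`, although
-- the type alone does not say that `s` is `loop n`.
data Equation (A : Set) : Set where
  equation : {x y : A} → x ≡ y → Equation A

trace-step : (h : Box → ℕ) {b : Box} (F : GF2^ (suc (h b))) → let open GF2^ F in ∀ x →
             Σ Carrier λ s → Tr x ≡ (x ^ᶠ (2 ^ h b)) + s
trace-step h F x = _ , refl

trace-loop : (h : Box → ℕ) {n : ℕ} (F : GF2^ (suc (markedSuc h (box n)))) → let open GF2^ F in ∀ x (e : n ≡ n) →
             Σ Carrier λ s → proj₁ (trace-step (markedSuc h) {box n} F x) ≡ (x ^ᶠ (2 ^ h (box n))) + s ×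
             Σ (s ≡ s) λ p → Σ (ℕ → Carrier) λ loop → equation p ≡ equation (cong loop e)
trace-loop h F x e = _ , refl , cong! e , _ , refl

-- The absolute trace as a nonzero additive functional

module Trace {n} (F : GF2^ (suc (suc n))) where
  open Field F public
  open Solver using (solve; _:+_; _:*_; _:=_; con)

  private
    m = suc (suc n)

    loop : Carrier → ℕ → Carrier
    loop x = proj₁ (proj₂ (proj₂ (proj₂ (trace-loop unbox F x refl))))

    loop≡partialTrace : ∀ x i → loop x i ≡ partialTrace x i
    loop≡partialTrace x zero    = refl
    loop≡partialTrace x (suc i) = cong ((x ^ᶠ (2 ^ i)) +_) (loop≡partialTrace x i)

  Tr≡partialTrace : ∀ x → Tr x ≡ partialTrace x m
  Tr≡partialTrace x = loop≡partialTrace x m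

  Tr-+ : ∀ x y → Tr (x + y) ≡ Tr x + Tr y
  Tr-+ x y = trans (Tr≡partialTrace (x + y)) (trans (partialTrace-+ x y m)
    (sym (cong₂ _+_ (Tr≡partialTrace x) (Tr≡partialTrace y))))

  Tr-idempotent : ∀ x → Tr x * Tr x ≡ Tr x
  Tr-idempotent x = begin
    Tr x * Tr x                              ≡⟨ cong₂ _*_ (Tr≡partialTrace x) (Tr≡partialTrace x) ⟩
    partialTrace x m * partialTrace x m      ≡⟨ partialTrace-square x m ⟩
    (x ^ᶠ (2 ^ m)) + x + partialTrace x m    ≡⟨ cong (λ y → y + x + partialTrace x m) (x^2^m≡x x) ⟩
    x + x + partialTrace x m                 ≡⟨ solve 2 (λ x t → x :+ x :+ t := t) refl x (partialTrace x m) ⟩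
    partialTrace x m                         ≡⟨ Tr≡partialTrace x ⟨
    Tr x                                     ∎
    where open ≡-Reasoning

  -- An idempotent of a field is 0 or 1.
  Tr≡⟦tr⟧ : ∀ x → Tr x ≡ ⟦ tr x ⟧
  Tr≡⟦tr⟧ x with Tr x ≟ 0#
  ... | yes e = e
  ... | no  e = *-cancelˡ (Tr x) e (trans (Tr-idempotent x) (solve 1 (λ t → t := t :* con true) refl (Tr x)))

  ⟦⟧-injective : ∀ {a b} → ⟦ a ⟧ ≡ ⟦ b ⟧ → a ≡ b
  ⟦⟧-injective {false} {false} _ = refl
  ⟦⟧-injective {false} {true}  e = contradiction (sym e) 1≢0
  ⟦⟧-injective {true}  {false} e = contradiction e 1≢0
  ⟦⟧-injective {true}  {true}  _ = refl

  tr-+ : ∀ x y → tr (x + y) ≡ tr x xor tr y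
  tr-+ x y = ⟦⟧-injective (begin
    ⟦ tr (x + y) ⟧         ≡⟨ Tr≡⟦tr⟧ (x + y) ⟨
    Tr (x + y)             ≡⟨ Tr-+ x y ⟩
    Tr x + Tr y            ≡⟨ cong₂ _+_ (Tr≡⟦tr⟧ x) (Tr≡⟦tr⟧ y) ⟩
    ⟦ tr x ⟧ + ⟦ tr y ⟧    ≡⟨ ⟦⟧-xor (tr x) (tr y) ⟨
    ⟦ tr x xor tr y ⟧      ∎)
    where open ≡-Reasoning

  -- Otherwise a polynomial of degree 2^(m-1) would have all 2^m field elements as roots.
  trace-one : ∃ λ s → tr s ≡ true
  trace-one with All.all? (λ x → partialTrace x m ≟ 0#) elements
  ... | yes zeros = contradiction zeros
    (root-bound 1≢0 (poly-partialTrace (suc n)) elements elements-unique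
      (subst (2 ^ suc n <_) (sym length-elements) (N.^-monoʳ-< 2 (s≤s (s≤s z≤n)) (N.n<1+n (suc n)))))
  ... | no ¬zeros with s , s≢0 ← Any.satisfied (All.¬All⇒Any¬ (λ x → partialTrace x m ≟ 0#) elements ¬zeros) =
    s , cong not (dec-false (Tr s ≟ 0#) (s≢0 ∘ trans (sym (Tr≡partialTrace s))))

-- The trace form and duality

module TraceForm {m} (F : GF2^ m) (t : GF2^.Carrier F → Bool)
                 (t-+ : ∀ x y → t (GF2^._+_ F x y) ≡ t x xor t y) (t-nonzero : ∃ λ s → t s ≡ true) where
  open Field F public

  t-0 : t 0# ≡ false
  t-0 = trans (sym (cong t (+-identityˡ 0#))) (trans (t-+ 0# 0#) (xor-same (t 0#)))

  trace-form-hits : ∀ {c} → ¬ c ≡ 0# → ∃ λ x → t (x * c) ≡ true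
  trace-form-hits {c} n = inv c * s , trans (cong t (trans (*-comm _ c) (inv-cancel c s n))) (proj₂ t-nonzero)
    where s = proj₁ t-nonzero

  trace-form-nondegenerate : ∀ {c} → (∀ x → t (x * c) ≡ false) → c ≡ 0#
  trace-form-nondegenerate {c} z with c ≟ 0#
  ... | yes e = e
  ... | no  n with x , e ← trace-form-hits n = contradiction (trans (sym e) (z x)) λ ()

  trace-form-linear : ∀ c → Linear (λ v → t (uncoord v * c))
  trace-form-linear c u v = trans (cong t (trans (cong (_* c) (uncoord-⊕ u v)) (distribʳ c _ _))) (t-+ _ _)

  functional : Carrier → BV m
  functional c = coefficients (λ v → t (uncoord v * c))

  functional-injective : ∀ u v → functional (uncoord u) ≡ functional (uncoord v) → u ≡ v
  functional-injective u v e = uncoord-injective (+≡0⇒≡ (trace-form-nondegenerate λ x → begin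
    t (x * (uncoord u + uncoord v))
      ≡⟨ trans (cong t (distribˡ x _ _)) (t-+ _ _) ⟩
    t (x * uncoord u) xor t (x * uncoord v)
      ≡⟨ cong₂ _xor_ (evaluate (uncoord u) x) (evaluate (uncoord v) x) ⟩
    dot (functional (uncoord u)) (coord x) xor dot (functional (uncoord v)) (coord x)
      ≡⟨ cong (λ f → dot f (coord x) xor dot (functional (uncoord v)) (coord x)) e ⟩
    dot (functional (uncoord v)) (coord x) xor dot (functional (uncoord v)) (coord x)
      ≡⟨ xor-same (dot (functional (uncoord v)) (coord x)) ⟩
    false ∎))
    where
    open ≡-Reasoning
    evaluate : ∀ c x → t (x * c) ≡ dot (functional c) (coord x)
    evaluate c x = trans (cong (λ y → t (y * c)) (sym (uncoord-coord x)))
                         (sym (dot-coefficients _ (trace-form-linear c) (coord x)))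

  -- By nondegeneracy distinct `c` give distinct functionals. There are as many functionals as field
  -- elements, so every one of them occurs.
  trace-form-represents : ∀ (a : BV m) → ∃ λ c → ∀ v → dot a v ≡ t (uncoord v * c)
  trace-form-represents a = represent (injective⇒surjective (functional ∘ uncoord) functional-injective a)
    where
    represent : (∃ λ c → functional (uncoord c) ≡ a) → ∃ λ c → ∀ v → dot a v ≡ t (uncoord v * c)
    represent (c , e) = uncoord c , λ v → trans (cong (λ f → dot f v) (sym e)) (dot-coefficients _ (trace-form-linear (uncoord c)) v)

-- Power permutations and their derivatives

true·ᵥ : ∀ {n} (v : BV n) → true ·ᵥ v ≡ v
true·ᵥ = Vec.map-id

false·ᵥ : ∀ {n} (v : BV n) → false ·ᵥ v ≡ zeroV
false·ᵥ []      = refl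
false·ᵥ (_ ∷ v) = cong (false ∷_) (false·ᵥ v)

-- Over F₂ the only possible nontrivial relations are v = 0, w = 0 and v + w = 0.
linIndep : ∀ {n} {v w : BV n} → ¬ v ≡ zeroV → ¬ w ≡ zeroV → ¬ v ≡ w → LinIndep v w
linIndep nv nw n false false e = refl , refl
linIndep {v = v} {w} nv nw n false true e =
  contradiction (trans (sym (⊕-identityˡ w)) (trans (sym (cong₂ _⊕_ (false·ᵥ v) (true·ᵥ w))) e)) nw
linIndep {v = v} {w} nv nw n true false e =
  contradiction (trans (sym (⊕-identityʳ v)) (trans (sym (cong₂ _⊕_ (true·ᵥ v) (false·ᵥ w))) e)) nv
linIndep {v = v} {w} nv nw n true true e =
  contradiction (⊕≡0⇒≡ v w (trans (sym (cong₂ _⊕_ (true·ᵥ v) (true·ᵥ w))) e)) n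

module PowerMaps {m} (F : GF2^ m) (t : GF2^.Carrier F → Bool)
                 (t-+ : ∀ x y → t (GF2^._+_ F x y) ≡ t x xor t y) (t-nonzero : ∃ λ s → t s ≡ true)
                 (d : ℕ) (1≤d : 1 ≤ d) (d²≡1 : (2 ^ m ∸ 1) ∣ (d N.* d ∸ 1)) where
  open TraceForm F t t-+ t-nonzero public
  open Solver using (solve; _:+_; _:*_; _:=_; con)

  t-+* : ∀ x y p → t ((x + y) * p) ≡ t (x * p) xor t (y * p)
  t-+* x y p = trans (cong t (distribʳ p x y)) (t-+ _ _)

  t-*+ : ∀ x p q → t (x * (p + q)) ≡ t (x * p) xor t (x * q)
  t-*+ x p q = trans (cong t (distribˡ x p q)) (t-+ _ _)

  ^d-involutive : ∀ x → (x ^ᶠ d) ^ᶠ d ≡ x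
  ^d-involutive x = trans (sym (^-* x d d)) (^-mod (N.*-mono-≤ 1≤d 1≤d) d²≡1 x)

  ^d-injective : ∀ {x y} → x ^ᶠ d ≡ y ^ᶠ d → x ≡ y
  ^d-injective {x} {y} e = trans (sym (^d-involutive x)) (trans (cong (_^ᶠ d) e) (^d-involutive y))

  module _ (α : Carrier) (α≢0 : ¬ α ≡ 0#) (p1 : P1 (toVecMap (λ y → α * (y ^ᶠ d)))) where

    private
      π : Carrier → Carrier
      π y = α * (y ^ᶠ d)

    π-injective : ∀ {x y} → π x ≡ π y → x ≡ y
    π-injective e = ^d-injective (*-cancelˡ α α≢0 e)

    P1-dependent : ∀ y v w → π y + π (y + v) + π (y + w) + π (y + v + w) ≡ 0# → ¬ v ≡ 0# → w ≡ 0# ⊎ w ≡ v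
    P1-dependent y v w e nv with w ≟ 0# | w ≟ v
    ... | yes p | _     = inj₁ p
    ... | no _  | yes p = inj₂ p
    ... | no nw | no n  = contradiction vanish
      (p1 (coord v) (coord w) (coord y)
        (linIndep (nv ∘ to-0) (nw ∘ to-0) (n ∘ sym ∘ coord-injective)))
      where
      open ≡-Reasoning
      to-0 : ∀ {x} → coord x ≡ zeroV → x ≡ 0#
      to-0 q = coord-injective (trans q (sym coord-0))
      f : BV m → BV m
      f = toVecMap π
      f-coord : ∀ x → f (coord x) ≡ coord (π x)
      f-coord x = cong (coord ∘ π) (uncoord-coord x)
      f₂ : ∀ x → f (coord y ⊕ coord x) ≡ coord (π (y + x))
      f₂ x = trans (cong f (sym (coord-+ y x))) (f-coord (y + x))
      f₃ : f (coord y ⊕ coord v ⊕ coord w) ≡ coord (π (y + v + w))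
      f₃ = trans (cong f (trans (cong (_⊕ coord w) (sym (coord-+ y v))) (sym (coord-+ (y + v) w)))) (f-coord (y + v + w))
      vanish : f (coord y) ⊕ f (coord y ⊕ coord v) ⊕ f (coord y ⊕ coord w) ⊕ f (coord y ⊕ coord v ⊕ coord w) ≡ zeroV
      vanish = begin
        f (coord y) ⊕ f (coord y ⊕ coord v) ⊕ f (coord y ⊕ coord w) ⊕ f (coord y ⊕ coord v ⊕ coord w)
          ≡⟨ cong₂ _⊕_ (cong₂ _⊕_ (cong₂ _⊕_ (f-coord y) (f₂ v)) (f₂ w)) f₃ ⟩
        coord (π y) ⊕ coord (π (y + v)) ⊕ coord (π (y + w)) ⊕ coord (π (y + v + w))
          ≡⟨ cong (λ u → u ⊕ coord (π (y + w)) ⊕ coord (π (y + v + w))) (coord-+ (π y) (π (y + v))) ⟨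
        coord (π y + π (y + v)) ⊕ coord (π (y + w)) ⊕ coord (π (y + v + w))
          ≡⟨ cong (_⊕ coord (π (y + v + w))) (coord-+ (π y + π (y + v)) (π (y + w))) ⟨
        coord (π y + π (y + v) + π (y + w)) ⊕ coord (π (y + v + w))
          ≡⟨ coord-+ (π y + π (y + v) + π (y + w)) (π (y + v + w)) ⟨
        coord (π y + π (y + v) + π (y + w) + π (y + v + w))
          ≡⟨ cong coord e ⟩
        coord 0#
          ≡⟨ coord-0 ⟩
        zeroV ∎

    -- π is APN by P1, so the derivative of π in direction e is 2-to-1.  Were it contained in the
    -- hyperplane t (a * x) = 0, then it would be all of it, and so contain 0.
    derivative-spans : ∀ {a e} → ¬ a ≡ 0# → ¬ e ≡ 0# → ¬ (∀ y → t (a * (π y + π (y + e))) ≡ false)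
    derivative-spans {a} {e} na ne h = zero-value (injective⇒surjective (coord ∘ G ∘ uncoord) G-injective zeroV)
      where
      Δ : Carrier → Carrier
      Δ y = π y + π (y + e)
      r s : Carrier
      r = proj₁ (trace-form-hits ne)
      s = proj₁ (trace-form-hits na)
      ℓ : Carrier → Bool
      ℓ y = t (r * y)
      -- `Δ` can agree only at y and y + e. Since `t (r * e)` is true, `ℓ` separates these two
      -- points; adding `s`, which lies off the hyperplane, where `ℓ` is true makes the map
      -- injective. A zero of `G` has `ℓ y` false and is thus a zero of `Δ`.
      G : Carrier → Carrier
      G y = Δ y + ⟦ ℓ y ⟧ * s
      t-⟦⟧ : ∀ b → t (a * (⟦ b ⟧ * s)) ≡ b
      t-⟦⟧ false = trans (cong t (solve 2 (λ a s → a :* (con false :* s) := con false) refl a s)) t-0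
      t-⟦⟧ true  = trans (cong t (solve 2 (λ a s → a :* (con true :* s) := s :* a) refl a s)) (proj₂ (trace-form-hits na))
      t-G : ∀ y → t (a * G y) ≡ ℓ y
      t-G y = trans (t-*+ a (Δ y) _) (cong₂ _xor_ (h y) (t-⟦⟧ (ℓ y)))
      Δ-cancel : ∀ {y z} → ℓ y ≡ ℓ z → G y ≡ G z → Δ y ≡ Δ z
      Δ-cancel {y} {z} p q = begin
        Δ y                               ≡⟨ solve 2 (λ x w → x := (x :+ w) :+ w) refl (Δ y) (⟦ ℓ y ⟧ * s) ⟩
        G y + ⟦ ℓ y ⟧ * s                 ≡⟨ cong₂ (λ x b → x + ⟦ b ⟧ * s) q p ⟩
        G z + ⟦ ℓ z ⟧ * s                 ≡⟨ solve 2 (λ x w → (x :+ w) :+ w := x) refl (Δ z) (⟦ ℓ z ⟧ * s) ⟩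
        Δ z                               ∎
        where open ≡-Reasoning
      Δ-fibre : ∀ {y z} → Δ y ≡ Δ z → y + z ≡ 0# ⊎ y + z ≡ e
      -- The points y, y + e, z and z + e form the plane through y with directions e and y + z.
      Δ-fibre {y} {z} q = P1-dependent y e (y + z) (trans
        (cong₂ (λ u v → π y + π (y + e) + π u + π v)
          (solve 2 (λ y z → y :+ (y :+ z) := z) refl y z)
          (solve 3 (λ y z e → y :+ e :+ (y :+ z) := z :+ e) refl y z e))
        (trans (solve 4 (λ a b c d → a :+ b :+ c :+ d := (a :+ b) :+ (c :+ d)) refl _ _ _ _)
               (trans (cong (_+ Δ z) q) (x+x≡0 (Δ z))))) ne
      G-inj : ∀ {y z} → G y ≡ G z → y ≡ z
      G-inj {y} {z} q = conclude (Δ-fibre (Δ-cancel p q))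
        where
        p : ℓ y ≡ ℓ z
        p = trans (sym (t-G y)) (trans (cong (λ x → t (a * x)) q) (t-G z))
        conclude : y + z ≡ 0# ⊎ y + z ≡ e → y ≡ z
        conclude (inj₁ w) = +≡0⇒≡ w
        conclude (inj₂ w) = contradiction (trans (sym (proj₂ (trace-form-hits ne)))
          (trans (cong ℓ (sym w)) (trans (t-*+ r y z) (trans (cong (_xor ℓ z) p) (xor-same (ℓ z)))))) λ ()
      G-injective : ∀ u v → coord (G (uncoord u)) ≡ coord (G (uncoord v)) → u ≡ v
      G-injective u v q = uncoord-injective (G-inj (coord-injective q))
      zero-value : ¬ ∃ λ u → coord (G (uncoord u)) ≡ zeroV
      zero-value (u , q) = ne e≡0
        where
        y : Carrier
        y = uncoord u
        Gy : G y ≡ 0#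
        Gy = coord-injective (trans q (sym coord-0))
        ℓy : ℓ y ≡ false
        ℓy = trans (sym (t-G y)) (trans (cong (λ x → t (a * x)) Gy) (trans (cong t (zeroʳ a)) t-0))
        Δy : Δ y ≡ 0#
        Δy = trans (trans (solve 2 (λ x s → x := x :+ con false :* s) refl (Δ y) s) (cong (λ b → Δ y + ⟦ b ⟧ * s) (sym ℓy))) Gy
        e≡0 : e ≡ 0#
        e≡0 = trans (solve 2 (λ y e → e := y :+ (y :+ e)) refl y e)
          (trans (cong (_+ (y + e)) (π-injective (+≡0⇒≡ Δy))) (x+x≡0 (y + e)))

  -- Distinct nonzero `P` and `Q` are independent over F₂, so their common annihilator has
  -- codimension 2, too small for 2^(m-1) values of `ξ`. In terms of counting, two further
  -- directions would extend `ξ` to an injection of 2^(m+1) points into a field with 2^m elements.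
  no-two-annihilators : ∀ {n} → suc n ≡ m → (ξ : BV n → Carrier) → (∀ u v → ξ u ≡ ξ v → u ≡ v) →
    ∀ {P Q} → ¬ P ≡ 0# → ¬ Q ≡ 0# → ¬ P ≡ Q → ¬ (∀ u → t (ξ u * P) ≡ false × t (ξ u * Q) ≡ false)
  no-two-annihilators {n} n+1≡m ξ ξ-injective {P} {Q} nP nQ nPQ h = choose (t (s * P)) refl
    where
    collide : ∀ {k} → suc n ≡ k → (f : BV (suc (suc n)) → BV k) → ∃₂ λ u v → ¬ u ≡ v × f u ≡ f v
    collide refl = collision
    s : Carrier
    s = proj₁ (trace-form-hits (≢⇒+≢0 nPQ))
    s-sum : t (s * (P + Q)) ≡ true
    s-sum = proj₂ (trace-form-hits (≢⇒+≢0 nPQ))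
    h+ : ∀ u → t (ξ u * (P + Q)) ≡ false
    h+ u = trans (t-*+ (ξ u) P Q) (cong₂ _xor_ (proj₁ (h u)) (proj₂ (h u)))
    -- Pairing a value of `G` with `A` recovers c, since both `s` and `ξ u` are annihilated by `A`.
    -- Pairing with `P + Q` then recovers b, and what remains is `ξ u`.
    extend : ∀ {A} → ¬ A ≡ 0# → t (s * A) ≡ false → (∀ u → t (ξ u * A) ≡ false) → ⊥
    extend {A} nA sA hA = impossible (collide n+1≡m (coord ∘ G))
      where
      r : Carrier
      r = proj₁ (trace-form-hits nA)
      G : BV (suc (suc n)) → Carrier
      G (b ∷ c ∷ u) = ξ u + ⟦ b ⟧ * s + ⟦ c ⟧ * r
      t-⟦⟧ : ∀ b x R → t (⟦ b ⟧ * x * R) ≡ b ∧ t (x * R)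
      t-⟦⟧ false x R = trans (cong t (solve 2 (λ x R → con false :* x :* R := con false) refl x R)) t-0
      t-⟦⟧ true  x R = cong t (solve 2 (λ x R → con true :* x :* R := x :* R) refl x R)
      t-G : ∀ R b c u → t (G (b ∷ c ∷ u) * R) ≡ (t (ξ u * R) xor (b ∧ t (s * R))) xor (c ∧ t (r * R))
      t-G R b c u = trans (t-+* _ _ R) (cong₂ _xor_ (trans (t-+* _ _ R) (cong (t (ξ u * R) xor_) (t-⟦⟧ b s R))) (t-⟦⟧ c r R))
      t-GA : ∀ b c u → t (G (b ∷ c ∷ u) * A) ≡ c
      t-GA b c u = trans (t-G A b c u)
        (trans (cong₂ _xor_ (cong₂ (λ x y → x xor (b ∧ y)) (hA u) sA) (cong (c ∧_) (proj₂ (trace-form-hits nA))))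
          (trans (cong (_xor (c ∧ true)) (∧-zeroʳ b)) (Bool.∧-identityʳ c)))
      t-G+ : ∀ b c u → t (G (b ∷ c ∷ u) * (P + Q)) ≡ b xor (c ∧ t (r * (P + Q)))
      t-G+ b c u = trans (t-G (P + Q) b c u)
        (cong (_xor (c ∧ t (r * (P + Q)))) (trans (cong₂ (λ x y → x xor (b ∧ y)) (h+ u) s-sum) (Bool.∧-identityʳ b)))
      xor-cancelʳ : ∀ {x y} z → x xor z ≡ y xor z → x ≡ y
      xor-cancelʳ {x} {y} z q = trans (add-twice x) (trans (cong (_xor z) q) (sym (add-twice y)))
        where
        add-twice : ∀ w → w ≡ (w xor z) xor z
        add-twice w = xor-∧-Solver.solve 2 (λ w z → w xor-∧-Solver.:= (w xor-∧-Solver.:+ z) xor-∧-Solver.:+ z) refl w z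
      G-injective : ∀ u v → G u ≡ G v → u ≡ v
      G-injective (b ∷ c ∷ u) (b′ ∷ c′ ∷ v) q = ∷-cong b≡b′ c≡c′ (ξ-injective u v (begin
        ξ u                                                ≡⟨ solve 3 (λ x y z → x := x :+ y :+ z :+ (y :+ z)) refl (ξ u) (⟦ b ⟧ * s) (⟦ c ⟧ * r) ⟩
        G (b ∷ c ∷ u) + (⟦ b ⟧ * s + ⟦ c ⟧ * r)            ≡⟨ cong₂ _+_ q (cong₂ (λ x y → ⟦ x ⟧ * s + ⟦ y ⟧ * r) b≡b′ c≡c′) ⟩
        G (b′ ∷ c′ ∷ v) + (⟦ b′ ⟧ * s + ⟦ c′ ⟧ * r)        ≡⟨ solve 3 (λ x y z → x :+ y :+ z :+ (y :+ z) := x) refl (ξ v) (⟦ b′ ⟧ * s) (⟦ c′ ⟧ * r) ⟩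
        ξ v                                                ∎))
        where
        open ≡-Reasoning
        ∷-cong : ∀ {b b′ c c′} {u v : BV n} → b ≡ b′ → c ≡ c′ → u ≡ v → b ∷ c ∷ u ≡ b′ ∷ c′ ∷ v
        ∷-cong refl refl refl = refl
        c≡c′ : c ≡ c′
        c≡c′ = trans (sym (t-GA b c u)) (trans (cong (λ x → t (x * A)) q) (t-GA b′ c′ v))
        b≡b′ : b ≡ b′
        b≡b′ = xor-cancelʳ (c ∧ t (r * (P + Q))) (trans (sym (t-G+ b c u)) (trans (cong (λ x → t (x * (P + Q))) q)
          (trans (t-G+ b′ c′ v) (cong (λ x → b′ xor (x ∧ t (r * (P + Q)))) (sym c≡c′)))))
      impossible : ¬ ∃₂ λ u v → ¬ u ≡ v × coord (G u) ≡ coord (G v)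
      impossible (u , v , n , q) = n (G-injective u v (coord-injective q))
    -- `t (s * P)` and `t (s * Q)` add up to true, so exactly one of `P` and `Q` annihilates `s` and
    -- can serve as `A`.
    choose : ∀ b → t (s * P) ≡ b → ⊥
    choose false e = extend nP e (proj₁ ∘ h)
    choose true  e = extend nQ (trans (sym (Bool.not-involutive (t (s * Q)))) (cong not (trans (cong (_xor t (s * Q)) (sym e)) (trans (sym (t-*+ s P Q)) s-sum)))) (proj₂ ∘ h)

-- Subspaces on which the second derivatives vanish

second-derivative : ∀ {n} → (BV n → Bool) → BV n → BV n → BV n → Bool
second-derivative g u v z = (g z xor g (z ⊕ u)) xor (g (z ⊕ v) xor g (z ⊕ u ⊕ v))

record Flat {n} (k : ℕ) (g : BV n → Bool) : Set where
  field
    direction : BV k → BV n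
    injective : ∀ u v → direction u ≡ direction v → u ≡ v
    additive  : Additive direction
    flat      : ∀ u v z → second-derivative g (direction u) (direction v) z ≡ false

-- A shift by (w , 0) adds `dot w (π y)`, and this increment is itself unchanged by such shifts.
MMfun-flat : ∀ k π h (u v : BV k) z → second-derivative (MMfun k π h) (u ++ zeroV) (v ++ zeroV) z ≡ false
MMfun-flat k π h u v z = begin
  (M z xor M (z ⊕ u′)) xor (M (z ⊕ v′) xor M (z ⊕ u′ ⊕ v′))
    ≡⟨ cong₂ (λ a b → (M z xor a) xor b) (shift z u)
         (cong₂ _xor_ (shift z v) (trans (shift (z ⊕ u′) v) (cong₂ _xor_ (shift z u) (cong (λ y → dot v (π y)) (drop-shift z u))))) ⟩
  (M z xor (M z xor a)) xor ((M z xor b) xor ((M z xor a) xor b))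
    ≡⟨ solve 3 (λ m a b → (m :+ (m :+ a)) :+ ((m :+ b) :+ ((m :+ a) :+ b)) := con false) refl (M z) a b ⟩
  false ∎
  where
  open ≡-Reasoning
  open xor-∧-Solver
  M = MMfun k π h
  u′ = u ++ zeroV {k}
  v′ = v ++ zeroV {k}
  a = dot u (π (drop k z))
  b = dot v (π (drop k z))
  drop-shift : ∀ z w → drop k (z ⊕ (w ++ zeroV {k})) ≡ drop k z
  drop-shift z w = trans (drop-⊕ k z (w ++ zeroV)) (trans (cong (drop k z ⊕_) (drop-++ w zeroV)) (⊕-identityʳ _))
  shift : ∀ z w → M (z ⊕ (w ++ zeroV)) ≡ M z xor dot w (π (drop k z))
  shift z w = begin
    dot (take k (z ⊕ (w ++ zeroV))) (π (drop k (z ⊕ (w ++ zeroV)))) xor h (drop k (z ⊕ (w ++ zeroV)))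
      ≡⟨ cong₂ (λ x y → dot x (π y) xor h y) (trans (take-⊕ k z (w ++ zeroV)) (cong (take k z ⊕_) (take-++ w zeroV))) (drop-shift z w) ⟩
    dot (take k z ⊕ w) (π (drop k z)) xor h (drop k z)
      ≡⟨ cong (_xor h (drop k z)) (dot-⊕ˡ (take k z) w (π (drop k z))) ⟩
    (dot (take k z) (π (drop k z)) xor dot w (π (drop k z))) xor h (drop k z)
      ≡⟨ solve 3 (λ x y z → (x :+ y) :+ z := (x :+ z) :+ y) refl (dot (take k z) (π (drop k z))) (dot w (π (drop k z))) (h (drop k z)) ⟩
    M z xor dot w (π (drop k z)) ∎

-- The directions form the preimage of the subspace of all (x , 0) under the linear part of A.
M#⇒flat : ∀ {N g} → InM# N g → ∃ λ k → k N.+ k ≡ N × Flat k g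
M#⇒flat {g = g} (k , refl , g′ , A , l , (π , h , _ , g′≡) , (M , c , A≡ , A-injective , A-surjective) , (a , c′ , l≡) , g≡) =
  k , refl , record { direction = φ ; injective = φ-injective ; additive = φ-additive ; flat = flat }
  where
  open ≡-Reasoning
  n = k N.+ k
  base : BV k → BV n
  base u = u ++ zeroV
  φ : BV k → BV n
  -- Adding `c` compensates the translation part of `A`, so that the matrix alone maps `φ u` to
  -- `base u`.
  φ u = proj₁ (A-surjective (base u ⊕ c))
  Aφ : ∀ u → A (φ u) ≡ base u ⊕ c
  Aφ u = proj₂ (A-surjective (base u ⊕ c)) refl
  Mφ : ∀ u → matApply M (φ u) ≡ base u
  Mφ u = begin
    matApply M (φ u)              ≡⟨ ⊕-cancelʳ _ c ⟨
    matApply M (φ u) ⊕ c ⊕ c      ≡⟨ cong (_⊕ c) (trans (sym (A≡ (φ u))) (Aφ u)) ⟩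
    base u ⊕ c ⊕ c                ≡⟨ ⊕-cancelʳ _ c ⟩
    base u                        ∎
  base-⊕ : ∀ {k} j (u v : BV k) → (u ++ zeroV {j}) ⊕ (v ++ zeroV) ≡ (u ⊕ v) ++ zeroV
  base-⊕ j []      []      = ⊕-identityˡ zeroV
  base-⊕ j (x ∷ u) (y ∷ v) = cong ((x xor y) ∷_) (base-⊕ j u v)
  φ-injective : ∀ u v → φ u ≡ φ v → u ≡ v
  φ-injective u v e = Vec.++-injectiveˡ u v (trans (sym (Mφ u)) (trans (cong (matApply M) e) (Mφ v)))
  φ-additive : Additive φ
  φ-additive u v = A-injective (begin
    A (φ (u ⊕ v))                                      ≡⟨ Aφ (u ⊕ v) ⟩
    base (u ⊕ v) ⊕ c                                   ≡⟨ cong (_⊕ c) (base-⊕ k u v) ⟨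
    base u ⊕ base v ⊕ c                                ≡⟨ cong₂ (λ x y → x ⊕ y ⊕ c) (Mφ u) (Mφ v) ⟨
    matApply M (φ u) ⊕ matApply M (φ v) ⊕ c            ≡⟨ cong (_⊕ c) (matApply-⊕ M (φ u) (φ v)) ⟨
    matApply M (φ u ⊕ φ v) ⊕ c                         ≡⟨ A≡ (φ u ⊕ φ v) ⟨
    A (φ u ⊕ φ v)                                      ∎)
  A-shift : ∀ z u → A (z ⊕ φ u) ≡ A z ⊕ base u
  A-shift z u = begin
    A (z ⊕ φ u)                         ≡⟨ A≡ (z ⊕ φ u) ⟩
    matApply M (z ⊕ φ u) ⊕ c            ≡⟨ cong (_⊕ c) (trans (matApply-⊕ M z (φ u)) (cong (matApply M z ⊕_) (Mφ u))) ⟩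
    matApply M z ⊕ base u ⊕ c           ≡⟨ trans (⊕-assoc _ _ c) (trans (cong (matApply M z ⊕_) (⊕-comm _ c)) (sym (⊕-assoc _ c _))) ⟩
    matApply M z ⊕ c ⊕ base u           ≡⟨ cong (_⊕ base u) (A≡ z) ⟨
    A z ⊕ base u                        ∎
  g-split : ∀ z → g z ≡ MMfun k π h (A z) xor (dot a z xor c′)
  g-split z = trans (g≡ z) (cong₂ _xor_ (g′≡ (A z)) (l≡ z))
  flat : ∀ u v z → second-derivative g (φ u) (φ v) z ≡ false
  flat u v z = begin
    (g z xor g (z ⊕ φ u)) xor (g (z ⊕ φ v) xor g (z ⊕ φ u ⊕ φ v))
      ≡⟨ cong₂ _xor_
           (cong₂ _xor_ (g-split z) (trans (g-split (z ⊕ φ u)) (cong₂ (λ x y → K x xor (y xor c′)) (A-shift z u) (dot-⊕ʳ a z (φ u)))))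
           (cong₂ _xor_ (trans (g-split (z ⊕ φ v)) (cong₂ (λ x y → K x xor (y xor c′)) (A-shift z v) (dot-⊕ʳ a z (φ v))))
             (trans (g-split (z ⊕ φ u ⊕ φ v)) (cong₂ (λ x y → K x xor (y xor c′))
               (trans (A-shift (z ⊕ φ u) v) (cong (_⊕ base v) (A-shift z u)))
               (trans (dot-⊕ʳ a (z ⊕ φ u) (φ v)) (cong (_xor dot a (φ v)) (dot-⊕ʳ a z (φ u))))))) ⟩
    -- The affine summand cancels: `dot a z` and `c′` occur four times each, `dot a (φ u)` and
    -- `dot a (φ v)` twice each.
    _ ≡⟨ solve 8 (λ k₀ k₁ k₂ k₃ x y w c → ((k₀ :+ (x :+ c)) :+ (k₁ :+ ((x :+ y) :+ c))) :+ ((k₂ :+ ((x :+ w) :+ c)) :+ (k₃ :+ (((x :+ y) :+ w) :+ c)))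
                   := (k₀ :+ k₁) :+ (k₂ :+ k₃)) refl
           (K (A z)) (K (A z ⊕ base u)) (K (A z ⊕ base v)) (K (A z ⊕ base u ⊕ base v)) (dot a z) (dot a (φ u)) (dot a (φ v)) c′ ⟩
    second-derivative K (base u) (base v) (A z)
      ≡⟨ MMfun-flat k π h u v (A z) ⟩
    false ∎
    where
    open xor-∧-Solver
    K = MMfun k π h

-- Impossibility of a flat of dimension m + 1

module NotFlat {j} (F : GF2^ (suc (suc (suc j)))) (t : GF2^.Carrier F → Bool)
               (t-+ : ∀ x y → t (GF2^._+_ F x y) ≡ t x xor t y) (t-nonzero : ∃ λ s → t s ≡ true)
               (d : ℕ) (1≤d : 1 ≤ d) (d²≡1 : (2 ^ suc (suc (suc j)) ∸ 1) ∣ (d N.* d ∸ 1))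
               (α : BV 2 → GF2^.Carrier F)
               (α≢0 : ∀ γ → ¬ α γ ≡ GF2^.0# F)
               (α-distinct : ∀ γ → ¬ γ ≡ zeroV → ¬ α zeroV ≡ α γ)
               (p1 : P1 (GF2^.toVecMap F (λ y → GF2^._*_ F (α zeroV) (GF2^._^ᶠ_ F y d))))
               (H : BV 2 → GF2^.Carrier F → Bool) where
  open PowerMaps F t t-+ t-nonzero d 1≤d d²≡1
  open Solver using (solve; _:+_; _:*_; _:=_; con)

  private
    m = suc (suc (suc j))

  π : BV 2 → Carrier → Carrier
  π γ y = α γ * (y ^ᶠ d)

  f : BV 2 → Carrier → Carrier → Bool
  f γ x y = t (x * π γ y) xor H γ y

  -- `X`, `Y` and `C` are the components of the directions in V: two field elements and the two
  -- selector bits of the concatenation.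
  module _ (X Y : BV (suc m) → Carrier) (C : BV (suc m) → BV 2)
           (X-+ : ∀ u v → X (u ⊕ v) ≡ X u + X v) (Y-+ : ∀ u v → Y (u ⊕ v) ≡ Y u + Y v) (C-⊕ : Additive C)
           (XYC-injective : ∀ u v → X u ≡ X v → Y u ≡ Y v → C u ≡ C v → u ≡ v)
           (flat : ∀ u v γ x y → (f γ x y xor f (γ ⊕ C u) (x + X u) (y + Y u)) xor
                     (f (γ ⊕ C v) (x + X v) (y + Y v) xor f (γ ⊕ C u ⊕ C v) (x + X u + X v) (y + Y u + Y v)) ≡ false)
           where

    -- The second derivative of `f` depends on x only through `t (x * p)`, where p is the sum in
    -- question; all other terms, including those from `H`, form the constant `rest`. Comparison
    -- with x = 0 shows that p is annihilated by the whole field.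
    π-derivative : ∀ u v γ y →
      (π γ y + π (γ ⊕ C u) (y + Y u)) + (π (γ ⊕ C v) (y + Y v) + π (γ ⊕ C u ⊕ C v) (y + Y u + Y v)) ≡ 0#
    π-derivative u v γ y = trace-form-nondegenerate λ x → begin
      t (x * ((p₀ + p₁) + (p₂ + p₃)))
        ≡⟨ trans (t-*+ x _ _) (cong₂ _xor_ (t-*+ x p₀ p₁) (t-*+ x p₂ p₃)) ⟩
      (t (x * p₀) xor t (x * p₁)) xor (t (x * p₂) xor t (x * p₃))
        ≡⟨ independent-of-x x ⟩
      (t (0# * p₀) xor t (0# * p₁)) xor (t (0# * p₂) xor t (0# * p₃))
        ≡⟨ cong₂ _xor_ (cong₂ _xor_ (t-0* p₀) (t-0* p₁)) (cong₂ _xor_ (t-0* p₂) (t-0* p₃)) ⟩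
      false ∎
      where
      open ≡-Reasoning
      p₀ = π γ y
      p₁ = π (γ ⊕ C u) (y + Y u)
      p₂ = π (γ ⊕ C v) (y + Y v)
      p₃ = π (γ ⊕ C u ⊕ C v) (y + Y u + Y v)
      t-0* : ∀ p → t (0# * p) ≡ false
      t-0* p = trans (cong t (zeroˡ p)) t-0
      rest : Bool
      rest = (H γ y xor (t (X u * p₁) xor H (γ ⊕ C u) (y + Y u))) xor
        ((t (X v * p₂) xor H (γ ⊕ C v) (y + Y v)) xor ((t (X u * p₃) xor t (X v * p₃)) xor H (γ ⊕ C u ⊕ C v) (y + Y u + Y v)))
      at : ∀ x → (t (x * p₀) xor t (x * p₁)) xor (t (x * p₂) xor t (x * p₃)) ≡ rest
      at x = trans (collect (t (x * p₀)) (t (x * p₁)) (t (x * p₂)) (t (x * p₃)) (H γ y) (t (X u * p₁)) (H (γ ⊕ C u) (y + Y u))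
                 (t (X v * p₂)) (H (γ ⊕ C v) (y + Y v)) (t (X u * p₃)) (t (X v * p₃)) (H (γ ⊕ C u ⊕ C v) (y + Y u + Y v)))
               (cong (_xor rest) (trans (sym (cong₂ (λ a b → (f γ x y xor a) xor b)
                   (cong (_xor H (γ ⊕ C u) (y + Y u)) (t-+* x (X u) p₁))
                   (cong₂ _xor_ (cong (_xor H (γ ⊕ C v) (y + Y v)) (t-+* x (X v) p₂))
                     (cong (_xor H (γ ⊕ C u ⊕ C v) (y + Y u + Y v)) (trans (t-+* (x + X u) (X v) p₃) (cong (_xor t (X v * p₃)) (t-+* x (X u) p₃)))))))
                 (flat u v γ x y)))
        where
        collect : ∀ a b c e h₀ r₁ h₁ r₂ h₂ r₃ s₃ h₃ → (a xor b) xor (c xor e) ≡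
          (((a xor h₀) xor ((b xor r₁) xor h₁)) xor (((c xor r₂) xor h₂) xor (((e xor r₃) xor s₃) xor h₃))) xor
          ((h₀ xor (r₁ xor h₁)) xor ((r₂ xor h₂) xor ((r₃ xor s₃) xor h₃)))
        collect = xor-∧-Solver.solve 12 (λ a b c e h₀ r₁ h₁ r₂ h₂ r₃ s₃ h₃ → (a :⊕ b) :⊕ (c :⊕ e) :≡
          ((((a :⊕ h₀) :⊕ ((b :⊕ r₁) :⊕ h₁)) :⊕ (((c :⊕ r₂) :⊕ h₂) :⊕ (((e :⊕ r₃) :⊕ s₃) :⊕ h₃))) :⊕
          ((h₀ :⊕ (r₁ :⊕ h₁)) :⊕ ((r₂ :⊕ h₂) :⊕ ((r₃ :⊕ s₃) :⊕ h₃))))) refl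
          where open xor-∧-Solver renaming (_:+_ to _:⊕_; _:=_ to _:≡_)
      independent-of-x : ∀ x → (t (x * p₀) xor t (x * p₁)) xor (t (x * p₂) xor t (x * p₃)) ≡
                               (t (0# * p₀) xor t (0# * p₁)) xor (t (0# * p₂) xor t (0# * p₃))
      independent-of-x x = trans (at x) (sym (at 0#))

    -- The derivative along (X u , 0 , 0) is `t (X u * π γ y)`, free of `H`. Flatness says that it
    -- does not change when the base point is shifted by the direction of `v`.
    annihilates : ∀ u v γ y → C u ≡ zeroV → Y u ≡ 0# → t (X u * (π γ y + π (γ ⊕ C v) (y + Y v))) ≡ false
    annihilates u v γ y Cu Yu = begin
      t (X u * (p + q))
        ≡⟨ t-*+ (X u) p q ⟩
      t (X u * p) xor t (X u * q)
        ≡⟨ collect (t (0# * p)) h (t (X u * p)) (t (0# * q)) h′ (t (X u * q)) (t (X v * q)) ⟩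
      ((t (0# * p) xor h) xor ((t (0# * p) xor t (X u * p)) xor h)) xor
        (((t (0# * q) xor t (X v * q)) xor h′) xor (((t (0# * q) xor t (X u * q)) xor t (X v * q)) xor h′))
        ≡⟨ cong₂ (λ a b → (f γ 0# y xor a) xor b)
             (cong (_xor h) (t-+* 0# (X u) p))
             (cong₂ _xor_ (cong (_xor h′) (t-+* 0# (X v) q))
               (cong (_xor h′) (trans (t-+* (0# + X u) (X v) q) (cong (_xor t (X v * q)) (t-+* 0# (X u) q))))) ⟨
      (f γ 0# y xor f γ (0# + X u) y) xor (f (γ ⊕ C v) (0# + X v) (y + Y v) xor f (γ ⊕ C v) (0# + X u + X v) (y + Y v))
        ≡⟨ cong₂ (λ γ′ y′ → (f γ 0# y xor f γ′ (0# + X u) y′) xor (f (γ ⊕ C v) (0# + X v) (y + Y v) xor f (γ′ ⊕ C v) (0# + X u + X v) (y′ + Y v)))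
             (trans (cong (γ ⊕_) Cu) (⊕-identityʳ γ)) (trans (cong (y +_) Yu) (+-identityʳ y)) ⟨
      (f γ 0# y xor f (γ ⊕ C u) (0# + X u) (y + Y u)) xor
        (f (γ ⊕ C v) (0# + X v) (y + Y v) xor f (γ ⊕ C u ⊕ C v) (0# + X u + X v) (y + Y u + Y v))
        ≡⟨ flat u v γ 0# y ⟩
      false ∎
      where
      open ≡-Reasoning
      p = π γ y
      q = π (γ ⊕ C v) (y + Y v)
      h = H γ y
      h′ = H (γ ⊕ C v) (y + Y v)
      collect : ∀ a h r b h′ r′ s → r xor r′ ≡ ((a xor h) xor ((a xor r) xor h)) xor (((b xor s) xor h′) xor (((b xor r′) xor s) xor h′))
      collect = xor-∧-Solver.solve 7 (λ a h r b h′ r′ s → r :⊕ r′ :≡ ((a :⊕ h) :⊕ ((a :⊕ r) :⊕ h)) :⊕ (((b :⊕ s) :⊕ h′) :⊕ (((b :⊕ r′) :⊕ s) :⊕ h′))) refl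
        where open xor-∧-Solver renaming (_:+_ to _:⊕_; _:=_ to _:≡_)

    open Subspace (kernel₂ C C-⊕) renaming (embed to ι; injective to ι-injective; additive to ι-additive; inside to Cι)

    Y-zeroV : Y zeroV ≡ 0#
    Y-zeroV = trans (cong Y (sym (⊕-self zeroV))) (trans (Y-+ zeroV zeroV) (x+x≡0 _))

    X-zeroV : X zeroV ≡ 0#
    X-zeroV = trans (cong X (sym (⊕-self zeroV))) (trans (X-+ zeroV zeroV) (x+x≡0 _))

    C-zeroV : C zeroV ≡ zeroV
    C-zeroV = trans (cong C (sym (⊕-self zeroV))) (trans (C-⊕ zeroV zeroV) (⊕-self _))

    ι-zeroV : ι zeroV ≡ zeroV
    ι-zeroV = trans (cong ι (sym (⊕-self zeroV))) (trans (ι-additive zeroV zeroV) (⊕-self _))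

    X≢0 : ∀ p → ¬ p ≡ zeroV → Y (ι p) ≡ 0# → ¬ X (ι p) ≡ 0#
    X≢0 p n Yp Xp = n (ι-injective p zeroV (trans
      (XYC-injective (ι p) zeroV (trans Xp (sym X-zeroV)) (trans Yp (sym Y-zeroV)) (trans (Cι p) (sym C-zeroV)))
      (sym ι-zeroV)))

    Y-vanishes : ∀ v → C v ≡ zeroV → Y v ≡ 0#
    Y-vanishes v Cv with Y v ≟ 0#
    ... | yes e = e
    ... | no  e≢0 = contradiction annihilates-derivative (derivative-spans (α zeroV) (α≢0 zeroV) p1 (X≢0 p p≢0 Yp) e≢0)
      where
      -- Both directions have zero selector bits, so `π-derivative` involves only `π zeroV`, to
      -- which P1 applies.
      dependent : ∀ p → Y (ι p) ≡ 0# ⊎ Y (ι p) ≡ Y v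
      dependent p = P1-dependent (α zeroV) (α≢0 zeroV) p1 0# (Y v) (Y (ι p)) (trans
        (cong₂ _+_ (cong₂ _+_ (cong (λ γ → π zeroV 0# + π γ (0# + Y v)) (sym C₁)) (cong (λ γ → π γ (0# + Y (ι p))) (sym C₂)))
          (cong (λ γ → π γ (0# + Y v + Y (ι p))) (sym (trans (cong₂ _⊕_ C₁ (Cι p)) (⊕-identityˡ zeroV)))))
        (trans (+-assoc _ _ _) (π-derivative v (ι p) zeroV 0#))) e≢0
        where
        C₁ : zeroV ⊕ C v ≡ zeroV
        C₁ = trans (⊕-identityˡ (C v)) Cv
        C₂ : zeroV ⊕ C (ι p) ≡ zeroV
        C₂ = trans (⊕-identityˡ (C (ι p))) (Cι p)
      -- As m is at least 3, there are two independent parameters. `Y` takes only the values 0 and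
      -- `Y v` on their images, so it vanishes on one of them or on their sum.
      vanishing : ∃ λ p → ¬ p ≡ zeroV × Y (ι p) ≡ 0#
      vanishing = choose (dependent e₁) (dependent e₂)
        where
        e₁ e₂ : BV (suc (suc j))
        e₁ = true ∷ false ∷ zeroV
        e₂ = false ∷ true ∷ zeroV
        choose : Y (ι e₁) ≡ 0# ⊎ Y (ι e₁) ≡ Y v → Y (ι e₂) ≡ 0# ⊎ Y (ι e₂) ≡ Y v → ∃ λ p → ¬ p ≡ zeroV × Y (ι p) ≡ 0#
        choose (inj₁ q) _        = e₁ , (λ ()) , q
        choose _        (inj₁ q) = e₂ , (λ ()) , q
        choose (inj₂ q) (inj₂ r) = e₁ ⊕ e₂ , (λ ()) ,
          trans (cong Y (ι-additive e₁ e₂)) (trans (Y-+ (ι e₁) (ι e₂)) (trans (cong₂ _+_ q r) (x+x≡0 (Y v))))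
      p = proj₁ vanishing
      p≢0 = proj₁ (proj₂ vanishing)
      Yp = proj₂ (proj₂ vanishing)
      annihilates-derivative : ∀ y → t (X (ι p) * (π zeroV y + π zeroV (y + Y v))) ≡ false
      annihilates-derivative y = trans (cong (λ γ → t (X (ι p) * (π zeroV y + π γ (y + Y v)))) (sym (trans (⊕-identityˡ (C v)) Cv)))
        (annihilates (ι p) v zeroV y (Cι p) Yp)

    contradictory : ⊥
    -- V has 2^(m+1) elements, but `X` has at most 2^m values. The sum w of two colliding elements
    -- is nonzero with `X w` zero. Were `C w` zero too, `Y w` would vanish by `Y-vanishes` and w
    -- would be zero; hence w has nonzero selector bits.
    contradictory = outside (collision (coord ∘ X))
      where
      Yι : ∀ p → Y (ι p) ≡ 0#
      Yι p = Y-vanishes (ι p) (Cι p)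
      ξ-injective : ∀ u v → X (ι u) ≡ X (ι v) → u ≡ v
      ξ-injective u v e = ι-injective u v (XYC-injective _ _ e (trans (Yι u) (sym (Yι v))) (trans (Cι u) (sym (Cι v))))
      module _ (w : BV (suc m)) (γ≢0 : ¬ C w ≡ zeroV) where
        γ = C w
        b = Y w
        αγ≢α₀ : ¬ α γ ≡ α zeroV
        αγ≢α₀ e = α-distinct γ γ≢0 (sym e)
        values : ∀ p y → t (X (ι p) * (π zeroV y + π γ (y + b))) ≡ false
        values p y = trans (cong (λ δ → t (X (ι p) * (π zeroV y + π δ (y + b)))) (sym (⊕-identityˡ γ)))
          (annihilates (ι p) w zeroV y (Cι p) (Yι p))
        b≡0⇒⊥ : b ≡ 0# → ⊥
        b≡0⇒⊥ b≡0 = contradiction (trans (sym (proj₂ (trace-form-hits cu≢0))) (trans (cong t eq) (values e₁ y))) λ ()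
          where
          e₁ : BV (suc (suc j))
          e₁ = true ∷ zeroV
          c = α zeroV + α γ
          cu≢0 : ¬ c * X (ι e₁) ≡ 0#
          cu≢0 = *-≢0 (≢⇒+≢0 (αγ≢α₀ ∘ sym)) (X≢0 e₁ (λ ()) (Yι e₁))
          z = proj₁ (trace-form-hits cu≢0)
          -- The power map is an involution, so `y ^ᶠ d` is `z` and the annihilator at this `y` is
          -- `c * z`.
          y = z ^ᶠ d
          eq : z * (c * X (ι e₁)) ≡ X (ι e₁) * (π zeroV y + π γ (y + b))
          eq = trans (solve 4 (λ z a a′ x → z :* ((a :+ a′) :* x) := x :* (a :* z :+ a′ :* z)) refl z (α zeroV) (α γ) (X (ι e₁)))
            (cong₂ (λ z₁ z₂ → X (ι e₁) * (α zeroV * z₁ + α γ * z₂)) (sym (^d-involutive z))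
              (sym (trans (cong (_^ᶠ d) (trans (cong (y +_) b≡0) (+-identityʳ y))) (^d-involutive z))))
        b≢0⇒⊥ : ¬ b ≡ 0# → ⊥
        b≢0⇒⊥ b≢0 = no-two-annihilators refl (X ∘ ι) ξ-injective
          {P = π γ b} {Q = π zeroV b} (*-≢0 (α≢0 γ) b^d≢0) (*-≢0 (α≢0 zeroV) b^d≢0)
          (λ e → αγ≢α₀ (*-cancelˡ (b ^ᶠ d) b^d≢0 (trans (*-comm _ _) (trans e (*-comm _ _)))))
          λ p → trans (cong (λ s → t (X (ι p) * s)) (sym at-0)) (values p 0#) ,
                trans (cong (λ s → t (X (ι p) * s)) (sym at-b)) (values p b)
          where
          b^d≢0 : ¬ b ^ᶠ d ≡ 0#
          b^d≢0 = ^≢0 d b≢0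
          π-0 : ∀ δ {y} → y ≡ 0# → π δ y ≡ 0#
          π-0 δ refl = trans (cong (α δ *_) (0^ 1≤d)) (zeroʳ (α δ))
          at-0 : π zeroV 0# + π γ (0# + b) ≡ π γ b
          at-0 = trans (cong₂ _+_ (π-0 zeroV refl) (cong (π γ) (+-identityˡ b))) (+-identityˡ _)
          at-b : π zeroV b + π γ (b + b) ≡ π zeroV b
          at-b = trans (cong (π zeroV b +_) (π-0 γ (x+x≡0 b))) (+-identityʳ _)
        w-impossible : ⊥
        w-impossible with b ≟ 0#
        ... | yes e = b≡0⇒⊥ e
        ... | no  n = b≢0⇒⊥ n
      outside : ¬ ∃₂ λ u v → ¬ u ≡ v × coord (X u) ≡ coord (X v)
      outside (u , v , n , q) = w-impossible (u ⊕ v) λ Cw → n (⊕≡0⇒≡ u v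
        (XYC-injective (u ⊕ v) zeroV
          (trans (trans (X-+ u v) (trans (cong (_+ X v) (coord-injective q)) (x+x≡0 (X v)))) (sym X-zeroV))
          (trans (Y-vanishes (u ⊕ v) Cw) (sym Y-zeroV))
          (trans Cw (sym C-zeroV))))

-- Walsh transforms

sign-xor : ∀ a b → sign (a xor b) ≡ sign a ℤ.* sign b
sign-xor false b     = sym (ℤ.*-identityˡ (sign b))
sign-xor true  false = refl
sign-xor true  true  = refl

listSum : List ℤ → ℤ
listSum = List.foldr ℤ._+_ (ℤ.+ 0)

Σᵥ : ∀ n → (BV n → ℤ) → ℤ
Σᵥ n g = listSum (List.map g (allVec n))

listSum-++ : ∀ xs ys → listSum (xs List.++ ys) ≡ listSum xs ℤ.+ listSum ys
listSum-++ List.[]       ys = sym (ℤ.+-identityˡ _)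
listSum-++ (x List.∷ xs) ys = trans (cong (ℤ._+_ x) (listSum-++ xs ys)) (sym (ℤ.+-assoc x _ _))

Σᵥ-cong : ∀ n {g h : BV n → ℤ} → (∀ v → g v ≡ h v) → Σᵥ n g ≡ Σᵥ n h
Σᵥ-cong n e = cong listSum (List.map-cong e (allVec n))

Σᵥ-suc : ∀ n (g : BV (suc n) → ℤ) → Σᵥ (suc n) g ≡ Σᵥ n (λ v → g (false ∷ v)) ℤ.+ Σᵥ n (λ v → g (true ∷ v))
Σᵥ-suc n g = begin
  listSum (List.map g (List.map (false ∷_) (allVec n) List.++ List.map (true ∷_) (allVec n)))
    ≡⟨ cong listSum (List.map-++ g (List.map (false ∷_) (allVec n)) _) ⟩
  listSum (List.map g (List.map (false ∷_) (allVec n)) List.++ List.map g (List.map (true ∷_) (allVec n)))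
    ≡⟨ listSum-++ (List.map g (List.map (false ∷_) (allVec n))) _ ⟩
  listSum (List.map g (List.map (false ∷_) (allVec n))) ℤ.+ listSum (List.map g (List.map (true ∷_) (allVec n)))
    ≡⟨ cong₂ (λ x y → listSum x ℤ.+ listSum y) (List.map-∘ (allVec n)) (List.map-∘ (allVec n)) ⟨
  Σᵥ n (λ v → g (false ∷ v)) ℤ.+ Σᵥ n (λ v → g (true ∷ v)) ∎
  where open ≡-Reasoning

Σᵥ-+ : ∀ n (g h : BV n → ℤ) → Σᵥ n (λ v → g v ℤ.+ h v) ≡ Σᵥ n g ℤ.+ Σᵥ n h
Σᵥ-+ n g h = go (allVec n)
  where
  interchange : ∀ a b c d → (a ℤ.+ b) ℤ.+ (c ℤ.+ d) ≡ (a ℤ.+ c) ℤ.+ (b ℤ.+ d)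
  interchange = solve-∀
  go : ∀ vs → listSum (List.map (λ v → g v ℤ.+ h v) vs) ≡ listSum (List.map g vs) ℤ.+ listSum (List.map h vs)
  go List.[]       = refl
  go (v List.∷ vs) = trans (cong (ℤ._+_ (g v ℤ.+ h v)) (go vs)) (interchange (g v) (h v) _ _)

Σᵥ-*ʳ : ∀ n (g : BV n → ℤ) c → Σᵥ n (λ v → g v ℤ.* c) ≡ Σᵥ n g ℤ.* c
Σᵥ-*ʳ n g c = go (allVec n)
  where
  go : ∀ vs → listSum (List.map (λ v → g v ℤ.* c) vs) ≡ listSum (List.map g vs) ℤ.* c
  go List.[]       = refl
  go (v List.∷ vs) = trans (cong (ℤ._+_ (g v ℤ.* c)) (go vs)) (sym (ℤ.*-distribʳ-+ c (g v) _))

Σᵥ-0 : ∀ n → Σᵥ n (λ _ → ℤ.+ 0) ≡ ℤ.+ 0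
Σᵥ-0 n = trans (Σᵥ-*ʳ n (λ _ → ℤ.+ 0) (ℤ.+ 0)) (ℤ.*-zeroʳ (Σᵥ n (λ _ → ℤ.+ 0)))

Σᵥ-swap : ∀ n k (g : BV n → BV k → ℤ) → Σᵥ n (λ u → Σᵥ k (g u)) ≡ Σᵥ k (λ v → Σᵥ n (λ u → g u v))
Σᵥ-swap zero    k g = trans (ℤ.+-identityʳ _) (Σᵥ-cong k (λ v → sym (ℤ.+-identityʳ _)))
Σᵥ-swap (suc n) k g = begin
  Σᵥ (suc n) (λ u → Σᵥ k (g u))
    ≡⟨ Σᵥ-suc n _ ⟩
  Σᵥ n (λ u → Σᵥ k (g (false ∷ u))) ℤ.+ Σᵥ n (λ u → Σᵥ k (g (true ∷ u)))
    ≡⟨ cong₂ ℤ._+_ (Σᵥ-swap n k (g ∘ (false ∷_))) (Σᵥ-swap n k (g ∘ (true ∷_))) ⟩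
  Σᵥ k (λ v → Σᵥ n (λ u → g (false ∷ u) v)) ℤ.+ Σᵥ k (λ v → Σᵥ n (λ u → g (true ∷ u) v))
    ≡⟨ Σᵥ-+ k _ _ ⟨
  Σᵥ k (λ v → Σᵥ n (λ u → g (false ∷ u) v) ℤ.+ Σᵥ n (λ u → g (true ∷ u) v))
    ≡⟨ Σᵥ-cong k (λ v → Σᵥ-suc n (λ u → g u v)) ⟨
  Σᵥ k (λ v → Σᵥ (suc n) (λ u → g u v)) ∎
  where open ≡-Reasoning

Σᵥ-++ : ∀ n k (g : BV (n N.+ k) → ℤ) → Σᵥ (n N.+ k) g ≡ Σᵥ n (λ u → Σᵥ k (λ v → g (u ++ v)))
Σᵥ-++ zero    k g = sym (ℤ.+-identityʳ _)
Σᵥ-++ (suc n) k g = trans (Σᵥ-suc (n N.+ k) g)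
  (trans (cong₂ ℤ._+_ (Σᵥ-++ n k (g ∘ (false ∷_))) (Σᵥ-++ n k (g ∘ (true ∷_)))) (sym (Σᵥ-suc n _)))

Σᵥ-single : ∀ n (g : BV n → ℤ) v₀ → (∀ v → ¬ v ≡ v₀ → g v ≡ ℤ.+ 0) → Σᵥ n g ≡ g v₀
Σᵥ-single zero    g []           z = ℤ.+-identityʳ _
Σᵥ-single (suc n) g (false ∷ v₀) z = trans (Σᵥ-suc n g) (trans
  (cong₂ ℤ._+_ (Σᵥ-single n (g ∘ (false ∷_)) v₀ (λ v ne → z _ (ne ∘ Vec.∷-injectiveʳ)))
    (trans (Σᵥ-cong n (λ v → z (true ∷ v) λ ())) (Σᵥ-0 n)))
  (ℤ.+-identityʳ _))
Σᵥ-single (suc n) g (true ∷ v₀) z = trans (Σᵥ-suc n g) (trans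
  (cong₂ ℤ._+_ (trans (Σᵥ-cong n (λ v → z (false ∷ v) λ ())) (Σᵥ-0 n))
    (Σᵥ-single n (g ∘ (true ∷_)) v₀ (λ v ne → z _ (ne ∘ Vec.∷-injectiveʳ))))
  (ℤ.+-identityˡ _))

Σᵥ-1 : ∀ n → Σᵥ n (λ _ → ℤ.+ 1) ≡ ℤ.+ (2 ^ n)
Σᵥ-1 zero    = refl
Σᵥ-1 (suc n) = trans (Σᵥ-suc n _) (trans (cong₂ ℤ._+_ (Σᵥ-1 n) (Σᵥ-1 n))
  (cong (λ k → ℤ.+ (2 ^ n N.+ k)) (sym (N.+-identityʳ (2 ^ n)))))

-- If `L` is true at the first unit vector, the two halves of the sum cancel. Otherwise they agree,
-- and the witness without its first coordinate serves for the recursion.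
character-sum : ∀ n (L : BV n → Bool) → Linear L → ∃ (λ v → L v ≡ true) → Σᵥ n (sign ∘ L) ≡ ℤ.+ 0
character-sum zero    L lin ([] , e) = contradiction (trans (sym e) (linear-zeroV L lin)) λ ()
character-sum (suc n) L lin (b ∷ v , e) =
  trans (Σᵥ-suc n (sign ∘ L)) (trans (cong (ℤ._+_ A) (trans (Σᵥ-cong n flip) (Σᵥ-*ʳ n (sign ∘ L′) (sign (L e₀))))) (halves (L e₀) refl))
  where
  L′ : BV n → Bool
  L′ = L ∘ (false ∷_)
  lin′ : Linear L′
  lin′ u w = lin (false ∷ u) (false ∷ w)
  e₀ : BV (suc n)
  e₀ = true ∷ zeroV
  A : ℤ
  A = Σᵥ n (sign ∘ L′)
  flip : ∀ w → sign (L (true ∷ w)) ≡ sign (L′ w) ℤ.* sign (L e₀)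
  flip w = trans (cong sign (linear-∷ L lin true w)) (trans (sign-xor (L e₀) (L′ w)) (ℤ.*-comm (sign (L e₀)) _))
  cancel : ∀ a → a ℤ.+ a ℤ.* sign true ≡ ℤ.+ 0
  cancel = solve-∀
  halves : ∀ b₀ → L e₀ ≡ b₀ → A ℤ.+ A ℤ.* sign b₀ ≡ ℤ.+ 0
  halves true  _ = cancel A
  halves false q = cong₂ (λ x y → x ℤ.+ y ℤ.* ℤ.+ 1) A≡0 A≡0
    where
    A≡0 : A ≡ ℤ.+ 0
    A≡0 = character-sum n L′ lin′ (v , trans (sym (trans (linear-∷ L lin b v)
      (trans (cong (λ x → (b ∧ x) xor L′ v) q) (cong (_xor L′ v) (∧-zeroʳ b))))) e)

-- An odd number of minus signs among four is one or three.
four-signs : ∀ (ε : BV 2 → Bool) →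
  ε (false ∷ false ∷ []) xor ε (false ∷ true ∷ []) xor ε (true ∷ false ∷ []) xor ε (true ∷ true ∷ []) ≡ true →
  Σᵥ 2 (sign ∘ ε) ≡ ℤ.+ 2 ⊎ Σᵥ 2 (sign ∘ ε) ≡ ℤ.- (ℤ.+ 2)
four-signs ε = cases (ε (false ∷ false ∷ [])) (ε (false ∷ true ∷ [])) (ε (true ∷ false ∷ [])) (ε (true ∷ true ∷ []))
  where
  total : Bool → Bool → Bool → Bool → ℤ
  total a b c d = sign a ℤ.+ (sign b ℤ.+ (sign c ℤ.+ (sign d ℤ.+ ℤ.+ 0)))
  cases : ∀ a b c d → a xor b xor c xor d ≡ true → total a b c d ≡ ℤ.+ 2 ⊎ total a b c d ≡ ℤ.- (ℤ.+ 2)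
  cases false false false true  _ = inj₁ refl
  cases false false true  false _ = inj₁ refl
  cases false true  false false _ = inj₁ refl
  cases true  false false false _ = inj₁ refl
  cases false true  true  true  _ = inj₂ refl
  cases true  false true  true  _ = inj₂ refl
  cases true  true  false true  _ = inj₂ refl
  cases true  true  true  false _ = inj₂ refl
  cases false false false false ()
  cases false false true  true  ()
  cases false true  false true  ()
  cases false true  true  false ()
  cases true  false false true  ()
  cases true  false true  false ()
  cases true  true  false false ()
  cases true  true  true  true  ()

-- concat4 g₁ g₂ g₃ g₄ restricts to g₃ at (1 , 0) and to g₂ at (0 , 1).
branch : BV 2 → Fin 4
branch (false ∷ false ∷ []) = # 0
branch (false ∷ true  ∷ []) = # 1
branch (true  ∷ false ∷ []) = # 2
branch (true  ∷ true  ∷ []) = # 3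

concat4-branch : ∀ {n} (g : Fin 4 → BV n → Bool) w →
  concat4 (g (# 0)) (g (# 1)) (g (# 2)) (g (# 3)) w ≡ g (branch (drop n w)) (take n w)
concat4-branch {n} g w with take n w | drop n w
... | z | (false ∷ false ∷ []) = solve 1 (λ a → a :+ (con false :+ (con false :+ con false)) := a) refl (g (# 0) z)
  where open xor-∧-Solver
... | z | (false ∷ true ∷ []) = solve 2 (λ a b → a :+ (con false :+ ((a :+ b) :+ con false)) := b) refl (g (# 0) z) (g (# 1) z)
  where open xor-∧-Solver
... | z | (true ∷ false ∷ []) = solve 2 (λ a c → a :+ ((a :+ c) :+ (con false :+ con false)) := c) refl (g (# 0) z) (g (# 2) z)
  where open xor-∧-Solver
... | z | (true ∷ true ∷ []) = solve 4 (λ a b c d → a :+ ((a :+ c) :+ ((a :+ b) :+ (a :+ (b :+ (c :+ d))))) := d) refl (g (# 0) z) (g (# 1) z) (g (# 2) z) (g (# 3) z)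
  where open xor-∧-Solver

-- Bentness of the concatenation

module Bent {m} (F : GF2^ m) (t : GF2^.Carrier F → Bool)
            (t-+ : ∀ x y → t (GF2^._+_ F x y) ≡ t x xor t y) (t-nonzero : ∃ λ s → t s ≡ true)
            (d : ℕ) (1≤d : 1 ≤ d) (d²≡1 : (2 ^ m ∸ 1) ∣ (d N.* d ∸ 1)) where
  open PowerMaps F t t-+ t-nonzero d 1≤d d²≡1
  open Solver using (solve; _:+_; _:*_; _:=_; con)

  -- For fixed second argument the sum over the first is a character sum, which vanishes unless `π`
  -- takes there the value `c` representing `a₁`. Only the preimage of `c` under `π` survives, with
  -- a factor 2^m.
  walsh-MM : ∀ α → ¬ α ≡ 0# → α ^ᶠ (d N.+ 1) ≡ 1# → (H : Carrier → Bool) (a₁ a₂ : BV m) →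
    let y = α * (proj₁ (trace-form-represents a₁) ^ᶠ d) in
    walsh (toBool2 (λ x y → t (x * (α * (y ^ᶠ d))) xor H y)) (a₁ ++ a₂) ≡ ℤ.+ (2 ^ m) ℤ.* sign (H y xor dot a₂ (coord y))
  walsh-MM α α≢0 unit H a₁ a₂ = begin
    walsh g (a₁ ++ a₂)
      ≡⟨ Σᵥ-++ m m _ ⟩
    Σᵥ m (λ u → Σᵥ m (λ v → sign (g (u ++ v) xor dot (a₁ ++ a₂) (u ++ v))))
      ≡⟨ Σᵥ-swap m m _ ⟩
    Σᵥ m (λ v → Σᵥ m (λ u → sign (g (u ++ v) xor dot (a₁ ++ a₂) (u ++ v))))
      ≡⟨ Σᵥ-cong m (λ v → trans (Σᵥ-cong m (λ u → summand u v)) (Σᵥ-*ʳ m _ _)) ⟩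
    Σᵥ m (λ v → inner v ℤ.* outer v)
      ≡⟨ Σᵥ-single m _ (coord y) (λ v ne → cong (ℤ._* outer v) (inner-0 v ne)) ⟩
    inner (coord y) ℤ.* outer (coord y)
      ≡⟨ cong₂ (λ i z → i ℤ.* sign (H z xor dot a₂ (coord y))) inner-y (uncoord-coord y) ⟩
    ℤ.+ (2 ^ m) ℤ.* sign (H y xor dot a₂ (coord y)) ∎
    where
    open ≡-Reasoning
    c = proj₁ (trace-form-represents a₁)
    y = α * (c ^ᶠ d)
    π : Carrier → Carrier
    π z = α * (z ^ᶠ d)
    g : BV (m N.+ m) → Bool
    g = toBool2 (λ x y → t (x * π y) xor H y)
    L : BV m → BV m → Bool
    L v u = t (uncoord u * (π (uncoord v) + c))
    inner outer : BV m → ℤ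
    inner v = Σᵥ m (sign ∘ L v)
    outer v = sign (H (uncoord v) xor dot a₂ v)
    summand : ∀ u v → sign (g (u ++ v) xor dot (a₁ ++ a₂) (u ++ v)) ≡ sign (L v u) ℤ.* outer v
    summand u v = trans (cong sign (begin
      g (u ++ v) xor dot (a₁ ++ a₂) (u ++ v)
        ≡⟨ cong₂ _xor_ (cong₂ (λ p q → t (uncoord p * π (uncoord q)) xor H (uncoord q)) (take-++ u v) (drop-++ u v)) (dot-++ a₁ u a₂ v) ⟩
      (t (uncoord u * π (uncoord v)) xor H (uncoord v)) xor (dot a₁ u xor dot a₂ v)
        ≡⟨ xor-interchange (t (uncoord u * π (uncoord v))) (H (uncoord v)) (dot a₁ u) (dot a₂ v) ⟩
      (t (uncoord u * π (uncoord v)) xor dot a₁ u) xor (H (uncoord v) xor dot a₂ v)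
        ≡⟨ cong (_xor (H (uncoord v) xor dot a₂ v)) (trans (cong (t (uncoord u * π (uncoord v)) xor_) (proj₂ (trace-form-represents a₁) u)) (sym (t-*+ (uncoord u) (π (uncoord v)) c))) ⟩
      L v u xor (H (uncoord v) xor dot a₂ v) ∎)) (sign-xor (L v u) _)
    πy≡c : π y ≡ c
    πy≡c = begin
      α * ((α * (c ^ᶠ d)) ^ᶠ d)             ≡⟨ cong (α *_) (*-^ α (c ^ᶠ d) d) ⟩
      α * ((α ^ᶠ d) * ((c ^ᶠ d) ^ᶠ d))      ≡⟨ *-assoc α _ _ ⟨
      α * (α ^ᶠ d) * ((c ^ᶠ d) ^ᶠ d)        ≡⟨ cong₂ _*_ (trans (cong (α ^ᶠ_) (N.+-comm 1 d)) unit) (^d-involutive c) ⟩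
      1# * c                                ≡⟨ *-identityˡ c ⟩
      c                                     ∎
    inner-0 : ∀ v → ¬ v ≡ coord y → inner v ≡ ℤ.+ 0
    inner-0 v ne = character-sum m (L v) (trace-form-linear _) (coord x , trans (cong (λ z → t (z * (π (uncoord v) + c))) (uncoord-coord x)) (proj₂ hit))
      where
      hit = trace-form-hits (≢⇒+≢0 {π (uncoord v)} {c} λ e → ne (trans (sym (coord-uncoord v))
        (cong coord (^d-injective (*-cancelˡ α α≢0 (trans e (sym πy≡c)))))))
      x = proj₁ hit
    inner-y : inner (coord y) ≡ ℤ.+ (2 ^ m)
    inner-y = trans (Σᵥ-cong m (λ u → cong sign (trans (cong (λ z → t (uncoord u * z)) zero′) (trans (cong t (zeroʳ (uncoord u))) t-0)))) (Σᵥ-1 m)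
      where
      zero′ : π (uncoord (coord y)) + c ≡ 0#
      zero′ = trans (cong (_+ c) (trans (cong π (uncoord-coord y)) πy≡c)) (x+x≡0 c)

  concat-bent : (α : Fin 4 → Carrier) → (∀ i → ¬ α i ≡ 0#) → (∀ i → α i ^ᶠ (d N.+ 1) ≡ 1#) →
    α (# 0) + α (# 1) + α (# 2) + α (# 3) ≡ 0# → (H : Fin 4 → Carrier → Bool) →
    (∀ c → let y = λ i → α i * (c ^ᶠ d) in
       (H (# 0) (y (# 0)) xor H (# 1) (y (# 1))) xor (H (# 2) (y (# 2)) xor H (# 3) (y (# 3))) ≡ true) →
    let g = λ i → toBool2 (λ x y → t (x * (α i * (y ^ᶠ d))) xor H i y) in
    IsBent (m N.+ m N.+ 2) (concat4 (g (# 0)) (g (# 1)) (g (# 2)) (g (# 3)))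
  concat-bent α α≢0 unit Σα≡0 H dual a = result (four-signs ε ε-odd)
    where
    open ≡-Reasoning
    g : Fin 4 → BV (m N.+ m) → Bool
    g i = toBool2 (λ x y → t (x * (α i * (y ^ᶠ d))) xor H i y)
    f : BV (m N.+ m N.+ 2) → Bool
    f = concat4 (g (# 0)) (g (# 1)) (g (# 2)) (g (# 3))
    a′ = take (m N.+ m) a
    a₁ = take m a′
    a₂ = drop m a′
    a₃ = drop (m N.+ m) a
    c = proj₁ (trace-form-represents a₁)
    y : Fin 4 → Carrier
    y i = α i * (c ^ᶠ d)
    -- Up to the common factor 2^m, the branch `b` contributes the sign of `ε b` to the Walsh value:
    -- its dual at `a′` plus the linear form of the selector bits.
    ε : BV 2 → Bool
    ε b = (H (branch b) (y (branch b)) xor dot a₂ (coord (y (branch b)))) xor dot a₃ b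
    summand : ∀ z b → sign (f (z ++ b) xor dot a (z ++ b)) ≡ sign (g (branch b) z xor dot a′ z) ℤ.* sign (dot a₃ b)
    summand z b = trans (cong sign (begin
      f (z ++ b) xor dot a (z ++ b)
        ≡⟨ cong₂ _xor_ (trans (concat4-branch g (z ++ b)) (cong₂ (λ q p → g (branch q) p) (drop-++ z b) (take-++ z b)))
             (trans (cong (λ s → dot s (z ++ b)) (sym (Vec.take++drop≡id (m N.+ m) a))) (dot-++ a′ z a₃ b)) ⟩
      g (branch b) z xor (dot a′ z xor dot a₃ b)
        ≡⟨ Bool.xor-assoc (g (branch b) z) (dot a′ z) (dot a₃ b) ⟨
      (g (branch b) z xor dot a′ z) xor dot a₃ b ∎)) (sign-xor (g (branch b) z xor dot a′ z) (dot a₃ b))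
    walsh-f : walsh f a ≡ Σᵥ 2 (sign ∘ ε) ℤ.* ℤ.+ (2 ^ m)
    walsh-f = begin
      walsh f a
        ≡⟨ Σᵥ-++ (m N.+ m) 2 _ ⟩
      Σᵥ (m N.+ m) (λ z → Σᵥ 2 (λ b → sign (f (z ++ b) xor dot a (z ++ b))))
        ≡⟨ Σᵥ-swap (m N.+ m) 2 (λ z b → sign (f (z ++ b) xor dot a (z ++ b))) ⟩
      Σᵥ 2 (λ b → Σᵥ (m N.+ m) (λ z → sign (f (z ++ b) xor dot a (z ++ b))))
        ≡⟨ Σᵥ-cong 2 (λ b → trans (Σᵥ-cong (m N.+ m) (λ z → summand z b)) (Σᵥ-*ʳ (m N.+ m) (λ z → sign (g (branch b) z xor dot a′ z)) (sign (dot a₃ b)))) ⟩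
      Σᵥ 2 (λ b → walsh (g (branch b)) a′ ℤ.* sign (dot a₃ b))
        ≡⟨ Σᵥ-cong 2 component ⟩
      Σᵥ 2 (λ b → sign (ε b) ℤ.* ℤ.+ (2 ^ m))
        ≡⟨ Σᵥ-*ʳ 2 (sign ∘ ε) (ℤ.+ (2 ^ m)) ⟩
      Σᵥ 2 (sign ∘ ε) ℤ.* ℤ.+ (2 ^ m) ∎
      where
      rotate : ∀ p s r → (p ℤ.* s) ℤ.* r ≡ (s ℤ.* r) ℤ.* p
      rotate = solve-∀
      component : ∀ b → walsh (g (branch b)) a′ ℤ.* sign (dot a₃ b) ≡ sign (ε b) ℤ.* ℤ.+ (2 ^ m)
      component b = begin
        walsh (g i) a′ ℤ.* sign (dot a₃ b)
          ≡⟨ cong (λ s → walsh (g i) s ℤ.* sign (dot a₃ b)) (Vec.take++drop≡id m a′) ⟨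
        walsh (g i) (a₁ ++ a₂) ℤ.* sign (dot a₃ b)
          ≡⟨ cong (ℤ._* sign (dot a₃ b)) (walsh-MM (α i) (α≢0 i) (unit i) (H i) a₁ a₂) ⟩
        (ℤ.+ (2 ^ m) ℤ.* sign (H i (y i) xor dot a₂ (coord (y i)))) ℤ.* sign (dot a₃ b)
          ≡⟨ rotate (ℤ.+ (2 ^ m)) (sign (H i (y i) xor dot a₂ (coord (y i)))) (sign (dot a₃ b)) ⟩
        (sign (H i (y i) xor dot a₂ (coord (y i))) ℤ.* sign (dot a₃ b)) ℤ.* ℤ.+ (2 ^ m)
          ≡⟨ cong (ℤ._* ℤ.+ (2 ^ m)) (sign-xor (H i (y i) xor dot a₂ (coord (y i))) (dot a₃ b)) ⟨
        sign (ε b) ℤ.* ℤ.+ (2 ^ m) ∎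
        where i = branch b
    Σy≡0 : y (# 0) + y (# 1) + y (# 2) + y (# 3) ≡ 0#
    Σy≡0 = trans (solve 5 (λ p q r s z → p :* z :+ q :* z :+ r :* z :+ s :* z := (p :+ q :+ r :+ s) :* z) refl (α (# 0)) (α (# 1)) (α (# 2)) (α (# 3)) (c ^ᶠ d))
      (trans (cong (_* (c ^ᶠ d)) Σα≡0) (zeroˡ _))
    dot-coord-+ : ∀ x z → dot a₂ (coord (x + z)) ≡ dot a₂ (coord x) xor dot a₂ (coord z)
    dot-coord-+ x z = trans (cong (dot a₂) (coord-+ x z)) (dot-⊕ʳ a₂ (coord x) (coord z))
    D : Fin 4 → Bool
    D i = dot a₂ (coord (y i))
    D-sum : D (# 0) xor D (# 1) xor D (# 2) xor D (# 3) ≡ false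
    D-sum = begin
      D (# 0) xor D (# 1) xor D (# 2) xor D (# 3)
        ≡⟨ reassociate (D (# 0)) (D (# 1)) (D (# 2)) (D (# 3)) ⟩
      ((D (# 0) xor D (# 1)) xor D (# 2)) xor D (# 3)
        ≡⟨ trans (dot-coord-+ _ (y (# 3))) (cong (_xor D (# 3)) (trans (dot-coord-+ _ (y (# 2))) (cong (_xor D (# 2)) (dot-coord-+ (y (# 0)) (y (# 1)))))) ⟨
      dot a₂ (coord (y (# 0) + y (# 1) + y (# 2) + y (# 3)))
        ≡⟨ cong (dot a₂) (trans (cong coord Σy≡0) coord-0) ⟩
      dot a₂ zeroV
        ≡⟨ linear-zeroV (dot a₂) (dot-⊕ʳ a₂) ⟩
      false ∎
      where
      reassociate : ∀ p q r s → p xor q xor r xor s ≡ ((p xor q) xor r) xor s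
      reassociate p q r s = sym (trans (Bool.xor-assoc (p xor q) r s) (Bool.xor-assoc p q (r xor s)))
    dots : ∀ (v : BV 2) → dot v (false ∷ false ∷ []) xor dot v (false ∷ true ∷ []) xor dot v (true ∷ false ∷ []) xor dot v (true ∷ true ∷ []) ≡ false
    dots (false ∷ false ∷ []) = refl
    dots (false ∷ true  ∷ []) = refl
    dots (true  ∷ false ∷ []) = refl
    dots (true  ∷ true  ∷ []) = refl
    ε-odd : ε (false ∷ false ∷ []) xor ε (false ∷ true ∷ []) xor ε (true ∷ false ∷ []) xor ε (true ∷ true ∷ []) ≡ true
    -- The terms with `a₂` cancel because the four `y i` sum to zero, those with `a₃` because the
    -- four vectors of F₂² do. Only the `H` terms of the duals remain.
    ε-odd = trans (collect (h (# 0)) (h (# 1)) (h (# 2)) (h (# 3)) (D (# 0)) (D (# 1)) (D (# 2)) (D (# 3))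
        (dot a₃ (false ∷ false ∷ [])) (dot a₃ (false ∷ true ∷ [])) (dot a₃ (true ∷ false ∷ [])) (dot a₃ (true ∷ true ∷ [])))
      (cong₂ _xor_ (dual c) (cong₂ _xor_ D-sum (dots a₃)))
      where
      h : Fin 4 → Bool
      h i = H i (y i)
      collect : ∀ h₀ h₁ h₂ h₃ x₀ x₁ x₂ x₃ z₀ z₁ z₂ z₃ →
        ((h₀ xor x₀) xor z₀) xor ((h₁ xor x₁) xor z₁) xor ((h₂ xor x₂) xor z₂) xor ((h₃ xor x₃) xor z₃) ≡
        ((h₀ xor h₁) xor (h₂ xor h₃)) xor ((x₀ xor x₁ xor x₂ xor x₃) xor (z₀ xor z₁ xor z₂ xor z₃))
      collect = xor-∧-Solver.solve 12 (λ h₀ h₁ h₂ h₃ x₀ x₁ x₂ x₃ z₀ z₁ z₂ z₃ →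
        ((h₀ :⊕ x₀) :⊕ z₀) :⊕ (((h₁ :⊕ x₁) :⊕ z₁) :⊕ (((h₂ :⊕ x₂) :⊕ z₂) :⊕ ((h₃ :⊕ x₃) :⊕ z₃))) :≡
        ((h₀ :⊕ h₁) :⊕ (h₂ :⊕ h₃)) :⊕ ((x₀ :⊕ (x₁ :⊕ (x₂ :⊕ x₃))) :⊕ (z₀ :⊕ (z₁ :⊕ (z₂ :⊕ z₃))))) refl
        where open xor-∧-Solver renaming (_:+_ to _:⊕_; _:=_ to _:≡_)
    half : (m N.+ m N.+ 2) N./ 2 ≡ suc m
    half = trans (cong (N._/ 2) eq) (N.m*n/n≡m (suc m) 2)
      where
      eq : m N.+ m N.+ 2 ≡ suc m N.* 2
      eq = trans (N.+-comm (m N.+ m) 2) (cong (λ k → suc (suc k)) (trans (cong (m N.+_) (sym (N.+-identityʳ m))) (N.*-comm 2 m)))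
    result : Σᵥ 2 (sign ∘ ε) ≡ ℤ.+ 2 ⊎ Σᵥ 2 (sign ∘ ε) ≡ ℤ.- (ℤ.+ 2) →
      walsh f a ≡ ℤ.+ (2 ^ ((m N.+ m N.+ 2) N./ 2)) ⊎ walsh f a ≡ ℤ.- (ℤ.+ (2 ^ ((m N.+ m N.+ 2) N./ 2)))
    result (inj₁ e) = inj₁ (trans walsh-f (trans (cong (ℤ._* ℤ.+ (2 ^ m)) e)
      (trans (sym (ℤ.pos-* 2 (2 ^ m))) (cong (λ k → ℤ.+ (2 ^ k)) (sym half)))))
    result (inj₂ e) = inj₂ (trans walsh-f (trans (cong (ℤ._* ℤ.+ (2 ^ m)) e)
      (trans (sym (ℤ.neg-distribˡ-* (ℤ.+ 2) (ℤ.+ (2 ^ m)))) (cong ℤ.-_ (trans (sym (ℤ.pos-* 2 (2 ^ m))) (cong (λ k → ℤ.+ (2 ^ k)) (sym half)))))))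

-- Coordinates on the domain and assembly of the two halves

double-injective : ∀ {k m} → k N.+ k ≡ m N.+ m N.+ 2 → k ≡ suc m
double-injective {k} {m} e = N.*-cancelˡ-≡ k (suc m) 2 (begin
  2 N.* k            ≡⟨ cong (k N.+_) (N.+-identityʳ k) ⟩
  k N.+ k            ≡⟨ e ⟩
  m N.+ m N.+ 2      ≡⟨ N.+-comm (m N.+ m) 2 ⟩
  2 N.+ (m N.+ m)    ≡⟨ cong suc (N.+-suc m m) ⟨
  suc m N.+ suc m    ≡⟨ cong (suc m N.+_) (N.+-identityʳ (suc m)) ⟨
  2 N.* suc m        ∎)
  where open ≡-Reasoning

module Coordinates {m} (F : GF2^ m) where
  open Field F

  xPart yPart : BV (m N.+ m N.+ 2) → Carrier
  xPart w = uncoord (take m (take (m N.+ m) w))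
  yPart w = uncoord (drop m (take (m N.+ m) w))

  bits : BV (m N.+ m N.+ 2) → BV 2
  bits = drop (m N.+ m)

  point : Carrier → Carrier → BV 2 → BV (m N.+ m N.+ 2)
  point x y γ = (coord x ++ coord y) ++ γ

  xPart-⊕ : ∀ u v → xPart (u ⊕ v) ≡ xPart u + xPart v
  xPart-⊕ u v = trans (cong uncoord (trans (cong (take m) (take-⊕ (m N.+ m) u v)) (take-⊕ m (take (m N.+ m) u) (take (m N.+ m) v)))) (uncoord-⊕ _ _)

  yPart-⊕ : ∀ u v → yPart (u ⊕ v) ≡ yPart u + yPart v
  yPart-⊕ u v = trans (cong uncoord (trans (cong (drop m) (take-⊕ (m N.+ m) u v)) (drop-⊕ m (take (m N.+ m) u) (take (m N.+ m) v)))) (uncoord-⊕ _ _)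

  bits-⊕ : Additive bits
  bits-⊕ = drop-⊕ (m N.+ m)

  xPart-point : ∀ x y γ → xPart (point x y γ) ≡ x
  xPart-point x y γ = trans (cong uncoord (trans (cong (take m) (take-++ (coord x ++ coord y) γ)) (take-++ (coord x) (coord y)))) (uncoord-coord x)

  yPart-point : ∀ x y γ → yPart (point x y γ) ≡ y
  yPart-point x y γ = trans (cong uncoord (trans (cong (drop m) (take-++ (coord x ++ coord y) γ)) (drop-++ (coord x) (coord y)))) (uncoord-coord y)

  bits-point : ∀ x y γ → bits (point x y γ) ≡ γ
  bits-point x y γ = drop-++ (coord x ++ coord y) γ

  parts-injective : ∀ u v → xPart u ≡ xPart v → yPart u ≡ yPart v → bits u ≡ bits v → u ≡ v
  parts-injective u v p q r = take-drop-injective (m N.+ m) u v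
    (take-drop-injective m (take (m N.+ m) u) (take (m N.+ m) v) (uncoord-injective p) (uncoord-injective q)) r

module Main {j} (F : GF2^ (suc (suc (suc j)))) (t : GF2^.Carrier F → Bool)
            (t-+ : ∀ x y → t (GF2^._+_ F x y) ≡ t x xor t y) (t-nonzero : ∃ λ s → t s ≡ true)
            (d : ℕ) (1≤d : 1 ≤ d) (d²≡1 : (2 ^ suc (suc (suc j)) ∸ 1) ∣ (d N.* d ∸ 1)) where
  open Bent F t t-+ t-nonzero d 1≤d d²≡1 using (concat-bent)
  open PowerMaps F t t-+ t-nonzero d 1≤d d²≡1
  open Coordinates F
  open Solver using (solve; _:+_; _:*_; _:=_; con)

  private
    m = suc (suc (suc j))

  module _ (α : Fin 4 → Carrier) (α₀≢α₁ : ¬ α (# 0) ≡ α (# 1)) (α₀≢α₂ : ¬ α (# 0) ≡ α (# 2)) (α₁≢α₂ : ¬ α (# 1) ≡ α (# 2))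
           (unit : ∀ i → α i ^ᶠ (d N.+ 1) ≡ 1#) (α₃≡ : α (# 3) ≡ α (# 0) + α (# 1) + α (# 2)) where

    α≢0 : ∀ i → ¬ α i ≡ 0#
    α≢0 i e = 1≢0 (trans (sym (unit i)) (trans (cong (_^ᶠ (d N.+ 1)) e) (0^ (N.m≤n+m 1 d))))

    Σα≡0 : α (# 0) + α (# 1) + α (# 2) + α (# 3) ≡ 0#
    Σα≡0 = trans (cong (α (# 0) + α (# 1) + α (# 2) +_) α₃≡) (x+x≡0 _)

    α-distinct : ∀ γ → ¬ γ ≡ zeroV → ¬ α (branch zeroV) ≡ α (branch γ)
    α-distinct (false ∷ false ∷ []) n = contradiction refl n
    α-distinct (false ∷ true  ∷ []) n = α₀≢α₁
    α-distinct (true  ∷ false ∷ []) n = α₀≢α₂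
    -- The sum of the first and last coefficient equals that of the two middle ones, so equality of
    -- the former would force equality of the latter.
    α-distinct (true  ∷ true  ∷ []) n e = α₁≢α₂ (+≡0⇒≡ (trans
      (solve 3 (λ a b c → b :+ c := a :+ (a :+ b :+ c)) refl (α (# 0)) (α (# 1)) (α (# 2)))
      (trans (cong (α (# 0) +_) (sym α₃≡)) (trans (cong (_+ α (# 3)) e) (x+x≡0 (α (# 3)))))))

    concat-∉M# : P1 (toVecMap (λ y → α (# 0) * (y ^ᶠ d))) → (H : Fin 4 → Carrier → Bool) →
      let g = λ i → toBool2 (λ x y → t (x * (α i * (y ^ᶠ d))) xor H i y) in
      ¬ InM# (m N.+ m N.+ 2) (concat4 (g (# 0)) (g (# 1)) (g (# 2)) (g (# 3)))
    concat-∉M# p1 H inM# = refute (M#⇒flat inM#)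
      where
      open NotFlat F t t-+ t-nonzero d 1≤d d²≡1 (α ∘ branch) (α≢0 ∘ branch) α-distinct p1 (H ∘ branch)
        using (contradictory) renaming (f to f′)
      g : Fin 4 → BV (m N.+ m) → Bool
      g i = toBool2 (λ x y → t (x * (α i * (y ^ᶠ d))) xor H i y)
      f : BV (m N.+ m N.+ 2) → Bool
      f = concat4 (g (# 0)) (g (# 1)) (g (# 2)) (g (# 3))
      f-parts : ∀ w {x y γ} → xPart w ≡ x → yPart w ≡ y → bits w ≡ γ → f w ≡ f′ γ x y
      f-parts w refl refl refl = concat4-branch g w
      refute′ : ¬ Flat (suc m) f
      refute′ flatness = contradictory (xPart ∘ φ) (yPart ∘ φ) (bits ∘ φ)
        (λ u v → trans (cong xPart (additive u v)) (xPart-⊕ (φ u) (φ v)))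
        (λ u v → trans (cong yPart (additive u v)) (yPart-⊕ (φ u) (φ v)))
        (λ u v → trans (cong bits (additive u v)) (bits-⊕ (φ u) (φ v)))
        (λ u v p q r → injective u v (parts-injective (φ u) (φ v) p q r))
        λ u v γ x y → let z = point x y γ in
          trans (sym (cong₂ _xor_
            (cong₂ _xor_ (f-parts z (xPart-point x y γ) (yPart-point x y γ) (bits-point x y γ)) (f-shift z u (xPart-point x y γ) (yPart-point x y γ) (bits-point x y γ)))
            (cong₂ _xor_ (f-shift z v (xPart-point x y γ) (yPart-point x y γ) (bits-point x y γ))
              (f-shift (z ⊕ φ u) v (x-shift z u (xPart-point x y γ)) (y-shift z u (yPart-point x y γ)) (γ-shift z u (bits-point x y γ))))))
            (flat u v z)
        where
        open Flat flatness renaming (direction to φ)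
        x-shift : ∀ z u {x} → xPart z ≡ x → xPart (z ⊕ φ u) ≡ x + xPart (φ u)
        x-shift z u e = trans (xPart-⊕ z (φ u)) (cong (_+ xPart (φ u)) e)
        y-shift : ∀ z u {y} → yPart z ≡ y → yPart (z ⊕ φ u) ≡ y + yPart (φ u)
        y-shift z u e = trans (yPart-⊕ z (φ u)) (cong (_+ yPart (φ u)) e)
        γ-shift : ∀ z u {γ} → bits z ≡ γ → bits (z ⊕ φ u) ≡ γ ⊕ bits (φ u)
        γ-shift z u e = trans (bits-⊕ z (φ u)) (cong (_⊕ bits (φ u)) e)
        f-shift : ∀ z u {x y γ} → xPart z ≡ x → yPart z ≡ y → bits z ≡ γ →
                  f (z ⊕ φ u) ≡ f′ (γ ⊕ bits (φ u)) (x + xPart (φ u)) (y + yPart (φ u))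
        f-shift z u p q r = f-parts (z ⊕ φ u) (x-shift z u p) (y-shift z u q) (γ-shift z u r)
      refute : ¬ (∃ λ k → k N.+ k ≡ m N.+ m N.+ 2 × Flat k f)
      refute (k , e , flatness) = refute′ (subst (λ k → Flat k f) (double-injective {k} {m} e) flatness)

    module _ (σ : Fin 4 → Fin 4) (σ-bijective : Bijective _≡_ _≡_ σ) (k : ℕ) where

      private
        h : Fin 4 → Carrier → Bool
        h i y = t (α (σ (next i)) * inv (α i ^ᶠ k) * (y ^ᶠ k))

      Σασ≡0 : α (σ (# 0)) + α (σ (# 1)) + α (σ (# 2)) + α (σ (# 3)) ≡ 0#
      Σασ≡0 = begin
        α (σ (# 0)) + α (σ (# 1)) + α (σ (# 2)) + α (σ (# 3))
          ≡⟨ sum-4 (α ∘ σ) ⟩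
        sum (α ∘ σ)
          ≡⟨ sum-permute α (permutation σ σ⁻¹ σσ⁻¹ (λ i → proj₁ σ-bijective (σσ⁻¹ (σ i)))) ⟨
        sum α
          ≡⟨ sum-4 α ⟨
        α (# 0) + α (# 1) + α (# 2) + α (# 3)
          ≡⟨ Σα≡0 ⟩
        0# ∎
        where
        open ≡-Reasoning
        open Algebra.Properties.CommutativeMonoid.Sum (CommutativeRing.+-commutativeMonoid ring) using (sum; sum-permute)
        σ⁻¹ : Fin 4 → Fin 4
        σ⁻¹ i = proj₁ (proj₂ σ-bijective i)
        σσ⁻¹ : ∀ i → σ (σ⁻¹ i) ≡ i
        σσ⁻¹ i = proj₂ (proj₂ σ-bijective i) refl
        sum-4 : ∀ a → a (# 0) + a (# 1) + a (# 2) + a (# 3) ≡ sum a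
        sum-4 a = solve 4 (λ p q r s → p :+ q :+ r :+ s := p :+ (q :+ (r :+ (s :+ con false)))) refl (a (# 0)) (a (# 1)) (a (# 2)) (a (# 3))

      -- This explains the denominator of the β: at the point `α i * w` the factor `α i ^ᶠ k`
      -- cancels, and the four functions differ only in the coefficient of `w ^ᶠ k`.
      h-dual : ∀ i w → h i (α i * w) ≡ t (α (σ (next i)) * (w ^ᶠ k))
      h-dual i w = cong t (begin
        a * inv b * ((α i * w) ^ᶠ k)     ≡⟨ cong (a * inv b *_) (*-^ (α i) w k) ⟩
        a * inv b * (b * (w ^ᶠ k))       ≡⟨ solve 4 (λ a i b w → a :* i :* (b :* w) := a :* (b :* (i :* w))) refl a (inv b) b (w ^ᶠ k) ⟩
        a * (b * (inv b * (w ^ᶠ k)))     ≡⟨ cong (a *_) (inv-cancel b (w ^ᶠ k) (^≢0 k (α≢0 i))) ⟩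
        a * (w ^ᶠ k)                     ∎)
        where
        open ≡-Reasoning
        a = α (σ (next i))
        b = α i ^ᶠ k

      -- After `h-dual` the coefficients are the four α in another order, so they still sum to zero.
      duals-sum : ∀ w → (h (# 0) (α (# 0) * w) xor h (# 1) (α (# 1) * w)) xor (h (# 2) (α (# 2) * w) xor h (# 3) (α (# 3) * w)) ≡ false
      duals-sum w = begin
        (h (# 0) (α (# 0) * w) xor h (# 1) (α (# 1) * w)) xor (h (# 2) (α (# 2) * w) xor h (# 3) (α (# 3) * w))
          ≡⟨ cong₂ _xor_ (cong₂ _xor_ (h-dual (# 0) w) (h-dual (# 1) w)) (cong₂ _xor_ (h-dual (# 2) w) (h-dual (# 3) w)) ⟩
        (t (α (σ (# 1)) * z) xor t (α (σ (# 2)) * z)) xor (t (α (σ (# 3)) * z) xor t (α (σ (# 0)) * z))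
          ≡⟨ trans (t-+* _ _ z) (cong₂ _xor_ (t-+* _ _ z) (t-+* _ _ z)) ⟨
        t ((α (σ (# 1)) + α (σ (# 2)) + (α (σ (# 3)) + α (σ (# 0)))) * z)
          ≡⟨ cong (λ s → t (s * z)) (solve 4 (λ p q r s → q :+ r :+ (s :+ p) := p :+ q :+ r :+ s) refl (α (σ (# 0))) (α (σ (# 1))) (α (σ (# 2))) (α (σ (# 3)))) ⟩
        t ((α (σ (# 0)) + α (σ (# 1)) + α (σ (# 2)) + α (σ (# 3))) * z)
          ≡⟨ cong (λ s → t (s * z)) Σασ≡0 ⟩
        t (0# * z)
          ≡⟨ trans (cong t (zeroˡ z)) t-0 ⟩
        false ∎
        where
        open ≡-Reasoning
        z = w ^ᶠ k

      conclusion : P1 (toVecMap (λ y → α (# 0) * (y ^ᶠ d))) →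
        let f₁ = λ x y → t (x * (α (# 0) * (y ^ᶠ d))) xor h (# 0) y
            f₂ = λ x y → t (x * (α (# 1) * (y ^ᶠ d))) xor h (# 1) y
            f₃ = λ x y → t (x * (α (# 2) * (y ^ᶠ d))) xor h (# 2) y
            f₄ = λ x y → t (x * (α (# 3) * (y ^ᶠ d))) xor (h (# 3) y xor true)
            f = concat4 (toBool2 f₁) (toBool2 f₂) (toBool2 f₃) (toBool2 f₄)
        in IsBent (m N.+ m N.+ 2) f × ¬ InM# (m N.+ m N.+ 2) f
      conclusion p1 =
        concat-bent α α≢0 unit Σα≡0 H
          (λ c → trans (flip-last (h (# 0) (α (# 0) * (c ^ᶠ d))) (h (# 1) (α (# 1) * (c ^ᶠ d))) (h (# 2) (α (# 2) * (c ^ᶠ d))) (h (# 3) (α (# 3) * (c ^ᶠ d))))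
                       (cong (_xor true) (duals-sum (c ^ᶠ d)))) ,
        concat-∉M# p1 H
        where
        H : Fin 4 → Carrier → Bool
        H Fin.zero                                  = h (# 0)
        H (Fin.suc Fin.zero)                        = h (# 1)
        H (Fin.suc (Fin.suc Fin.zero))              = h (# 2)
        -- The added constant makes the sum of the duals odd. Without it the four signs would have
        -- product +1 and add up to 0 or ±4 instead of ±2.
        H (Fin.suc (Fin.suc (Fin.suc Fin.zero))) y  = h (# 3) y xor true
        flip-last : ∀ a b c e → (a xor b) xor (c xor (e xor true)) ≡ ((a xor b) xor (c xor e)) xor true
        flip-last a b c e = trans (cong ((a xor b) xor_) (sym (Bool.xor-assoc c e true))) (sym (Bool.xor-assoc (a xor b) (c xor e) true))

theorem7 : (m : ℕ) → 3 ≤ m → (F : GF2^ m) →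
    let open GF2^ F in
    (d : ℕ) → 1 ≤ d → (2 ^ m ∸ 1) ∣ (d N.* d ∸ 1) → 1 < wt d →
    (α : Fin 4 → Carrier) →
    ¬ α (# 0) ≡ 0# → ¬ α (# 1) ≡ 0# → ¬ α (# 2) ≡ 0# →
    ¬ α (# 0) ≡ α (# 1) → ¬ α (# 0) ≡ α (# 2) → ¬ α (# 1) ≡ α (# 2) →
    (∀ i → α i ^ᶠ (d N.+ 1) ≡ 1#) →
    α (# 3) ≡ α (# 0) + α (# 1) + α (# 2) →
    (∀ i → P1 (toVecMap (λ y → α i * (y ^ᶠ d)))) →
    (σ : Fin 4 → Fin 4) → Bijective _≡_ _≡_ σ →
    (k : ℕ) → 1 ≤ k →
    let π : Fin 4 → Carrier → Carrier
        π i y = α i * (y ^ᶠ d)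
        β : Fin 4 → Carrier
        β i = α (σ (next i)) * inv (α i ^ᶠ k)
        h : Fin 4 → Carrier → Bool
        h i y = tr (β i * (y ^ᶠ k))
        f₁ = λ x y → tr (x * π (# 0) y) xor h (# 0) y
        f₂ = λ x y → tr (x * π (# 1) y) xor h (# 1) y
        f₃ = λ x y → tr (x * π (# 2) y) xor h (# 2) y
        f₄ = λ x y → tr (x * π (# 3) y) xor (h (# 3) y xor true)
        f = concat4 (toBool2 f₁) (toBool2 f₂) (toBool2 f₃) (toBool2 f₄)
    in IsBent (m N.+ m N.+ 2) f × ¬ InM# (m N.+ m N.+ 2) f
theorem7 (suc (suc (suc j))) (s≤s (s≤s (s≤s z≤n))) F d 1≤d d²≡1 _ α _ _ _ α₀≢α₁ α₀≢α₂ α₁≢α₂ unit α₃≡ p1 σ σ-bijective k _ =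
  Main.conclusion F (GF2^.tr F) tr-+ trace-one d 1≤d d²≡1 α α₀≢α₁ α₀≢α₂ α₁≢α₂ unit α₃≡ σ σ-bijective k (p1 (# 0))
  where open Trace F using (tr-+; trace-one)
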